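{- Let $(G,+)$ be a finite abelian group with identity $0$, $n$ a positive integer, $W=G\wr S_n$, let $\underline\sigma\in\Sigma_n(G)$ and let $Y$ be a nonempty subset of $W$ with inner distribution $(a_{\underline\lambda})_{\underline\lambda\in\Lambda_n(G)}$. Then $Y$ is a $\underline\sigma$-clique if and only if $a_{\underline\lambda}=0$ for all $\underline\lambda\in C(\underline\sigma)$ with $\underline\lambda(0)\neq(1^n)$.
   Context: $[n]=\{1,\dots,n\}$. $W=G\wr S_n$ consists of pairs $(g,\pi)$, $g\in G^n$, $\pi\in S_n$, with $(f,\pi)(g,\sigma)=(f+g^\pi,\pi\sigma)$, $g^\pi=(g_{\pi^{ -1}(1)},\dots,g_{\pi^{ -1}(n)})$. $\mathrm{Par}$ is the set of partitions; $(1^n)$ is the partition with $n$ parts equal to 1. $\Lambda_n(G)$: maps $\underline\lambda:G\to\mathrm{Par}$ with $\sum_g|\underline\lambda(g)|=n$; $\Sigma_n(G)$: maps $\underline\sigma$ from subgroups of $G$ to $\mathrm{Par}$ with $\sum_{U\le G}|\underline\sigma(U)|=n$. Tabloids: a $\underline\sigma$-tableau consists of, for each $U\le G$, the Young diagram of $\underline\sigma(U)$ with boxes filled by pairs $(c,i)$, $c\in G/U$, $i\in[n]$, all $i$ pairwise distinct; row-equivalence classes are $\underline\sigma$-tabloids; $W$ acts entrywise by $(g,\pi)\cdot(c,i)=(c+g_{\pi(i)},\pi(i))$. $H_{\underline\sigma}$ is the stabiliser of a fixed $\underline\sigma$-tabloid. A nonempty $Y\subseteq W$ is a $\underline\sigma$-clique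 if for all distinct $x,y\in Y$ no $\underline\sigma$-tabloid is fixed by $x^{ -1}y$. Conjugacy classes: for $(g,\pi)\in W$ and a cycle $(i_1\dots i_k)$ of $\pi$, its sign is $g_{i_1}+\dots+g_{i_k}$; the cycle type of $(g,\pi)$ is $\underline\lambda\in\Lambda_n(G)$ with $\underline\lambda(h)$ the partition of lengths of cycles of $\pi$ (including fixed points) of sign $h$. $C_{\underline\lambda}$ is the conjugacy class of elements of cycle type $\underline\lambda$. $C(\underline\sigma)$ is the set of $\underline\lambda\in\Lambda_n(G)$ with $C_{\underline\lambda}\cap H_{\underline\sigma}\neq\emptyset$. The inner distribution of $Y$ is $a_{\underline\lambda}=\frac{1}{|Y|}|\{(x,y)\in Y\times Y:x^{ -1}y\in C_{\underline\lambda}\}|$. -}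

module Defs where

open import Level using (0ℓ)
open import Data.Bool using (Bool; true; false; _∧_; if_then_else_)
open import Data.Nat.ListAction using (sum)
open import Data.Nat as ℕ using (ℕ; zero; suc; _<_; _≡ᵇ_)
import Data.Nat.Properties as ℕP
open import Data.Fin as Fin using (Fin; fromℕ<)
import Data.Fin.Properties as FinP
open import Data.Fin.Subset as Sub using (Subset; inside; outside)
open import Data.Fin.Permutation using (Permutation′; _⟨$⟩ʳ_; _⟨$⟩ˡ_; _∘ₚ_; flip)
open import Data.List as List using (List; []; _∷_; _++_; length; replicate; lookup; filter; cartesianProduct)
import Data.List.Properties as ListP
open import Data.List.Relation.Unary.All using (All)
open import Data.List.Relation.Binary.Pointwise using ()
open import Data.List.Relation.Unary.Linked using (Linked)
open import Data.List.Membership.Propositional using (_∈_)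
import Data.Vec.Properties as VecP
import Data.Vec as Vec
import Data.Bool
open import Data.Integer using (+_)
open import Data.Rational using (ℚ; _/_; 0ℚ)
open import Data.Product using (Σ; ∃; _×_; _,_; proj₁; proj₂)
open import Function using (_∘_)
open import Function.Bundles using (_↔_; Inverse)
open import Relation.Nullary using (¬_; Dec; yes; no; does; ⌊_⌋)
open import Relation.Nullary.Decidable using (map′)
open import Relation.Binary using (DecidableEquality)
open import Relation.Binary.PropositionalEquality using (_≡_; _≢_; refl; subst; sym; trans; cong)
open import Algebra.Core using (Op₁; Op₂)
open import Algebra.Structures using (IsAbelianGroup)

record FinAbGroup : Set₁ where
  infixl 6 _+_
  field
    Carrier        : Set
    _+_            : Op₂ Carrier
    0#             : Carrier
    -_             : Op₁ Carrier
    isAbelianGroup : IsAbelianGroup _≡_ _+_ 0# -_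
    order          : ℕ
    enum           : Fin order ↔ Carrier
    _≟_            : DecidableEquality Carrier

Par : Set
Par = List ℕ

IsPartition : Par → Set
IsPartition p = All (0 <_) p × Linked ℕ._≥_ p

size : Par → ℕ
size = sum

countFin : ∀ {k} → (Fin k → Bool) → ℕ
countFin {zero}  f = 0
countFin {suc k} f = (if f Fin.zero then 1 else 0) ℕ.+ countFin (f ∘ Fin.suc)

sumFin : ∀ {k} → (Fin k → ℕ) → ℕ
sumFin {zero}  f = 0
sumFin {suc k} f = f Fin.zero ℕ.+ sumFin (f ∘ Fin.suc)

allSubsets : ∀ k → List (Subset k)
allSubsets zero    = Vec.[] ∷ []
allSubsets (suc k) = List.map (inside Vec.∷_) (allSubsets k) ++ List.map (outside Vec.∷_) (allSubsets k)

module Wreath (𝔾 : FinAbGroup) (n : ℕ) where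
  open FinAbGroup 𝔾

  G : Set
  G = Carrier

  index : G → Fin order
  index = Inverse.from enum

  elt : Fin order → G
  elt = Inverse.to enum

  record W : Set where
    constructor ⟨_,_⟩
    field
      vec  : Fin n → G
      perm : Permutation′ n
  open W public

  -- (f,π)(g,σ) = (f + g^π, πσ),  g^π i = g (π⁻¹ i),  (πσ) i = π (σ i)
  _·_ : W → W → W
  ⟨ f , π ⟩ · ⟨ g , σ ⟩ = ⟨ (λ i → f i + g (π ⟨$⟩ˡ i)) , σ ∘ₚ π ⟩

  _⁻¹ : W → W
  ⟨ g , π ⟩ ⁻¹ = ⟨ (λ j → - g (π ⟨$⟩ʳ j)) , flip π ⟩

  _≈W_ : W → W → Set
  x ≈W y = (∀ i → vec x i ≡ vec y i) × (∀ i → perm x ⟨$⟩ʳ i ≡ perm y ⟨$⟩ʳ i)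

  iter : Permutation′ n → ℕ → Fin n → Fin n
  iter π zero    i = i
  iter π (suc k) i = π ⟨$⟩ʳ iter π k i

  cycLen : Permutation′ n → Fin n → ℕ
  cycLen π i = search n 1
    where
    search : ℕ → ℕ → ℕ
    search zero    k = k
    search (suc f) k with iter π k i FinP.≟ i
    ... | yes _ = k
    ... | no  _ = search f (suc k)

  cycSign : W → Fin n → G
  cycSign ⟨ g , π ⟩ i = go (cycLen π i)
    where
    go : ℕ → G
    go zero    = 0#
    go (suc k) = g (iter π k i) + go k

  mult : W → ℕ → G → ℕ
  mult w k h = countFin (λ i → (cycLen (perm w) i ≡ᵇ suc k) ∧ ⌊ cycSign w i ≟ h ⌋) ℕ./ suc k

  cycleType : W → G → Par
  cycleType w h = parts n
    where
    parts : ℕ → Par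
    parts zero    = []
    parts (suc k) = replicate (mult w k h) (suc k) ++ parts k

  InΛ : (G → Par) → Set
  InΛ λ′ = (∀ h → IsPartition (λ′ h)) × sumFin (λ j → size (λ′ (elt j))) ≡ n

  InClass : W → (G → Par) → Set
  InClass w λ′ = ∀ h → cycleType w h ≡ λ′ h

  inClass? : ∀ w λ′ → Dec (InClass w λ′)
  inClass? w λ′ = map′ to fro (FinP.all? (λ j → ListP.≡-dec ℕP._≟_ (cycleType w (elt j)) (λ′ (elt j))))
    where
    to : (∀ j → cycleType w (elt j) ≡ λ′ (elt j)) → InClass w λ′
    to p h = subst (λ x → cycleType w x ≡ λ′ x) (Inverse.strictlyInverseˡ enum h) (p (index h))
    fro : InClass w λ′ → ∀ j → cycleType w (elt j) ≡ λ′ (elt j)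
    fro p j = p (elt j)

  _∈G_ : G → Subset order → Set
  x ∈G U = index x Sub.∈ U

  record IsSubgroup (U : Subset order) : Set where
    field
      has-0 : 0# ∈G U
      +-closed : ∀ {x y} → x ∈G U → y ∈G U → (x + y) ∈G U
      neg-closed : ∀ {x} → x ∈G U → (- x) ∈G U

  -- σ ∈ Σ_n(G): a map from subgroups of G to partitions (represented as a
  -- map on all subsets that is [] off the subgroups), of total size n.
  InΣ : (Subset order → Par) → Set
  InΣ σ = (∀ U → IsPartition (σ U))
        × (∀ U → σ U ≢ [] → IsSubgroup U)
        × sum (List.map (size ∘ σ) (allSubsets order)) ≡ n

  -- A tabloid assigns to every label i ∈ [n] the box it
  -- occupies: a subgroup U, a row of the diagram of σ(U), and a coset
  -- c ∈ G/U (given by a representative).  Rows are unordered, so this is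
  -- exactly a row-equivalence class of tableaux.

  record Entry : Set where
    constructor entry
    field
      sub   : Subset order
      row   : ℕ
      coset : G
  open Entry public

  IsTabloid : (Subset order → Par) → (Fin n → Entry) → Set
  IsTabloid σ t =
      (∀ i → row (t i) < length (σ (sub (t i))))
    × (∀ U r → (r<l : r < length (σ U)) →
         countFin (λ i → does (VecP.≡-dec Data.Bool._≟_ (sub (t i)) U) ∧ (row (t i) ≡ᵇ r))
           ≡ lookup (σ U) (fromℕ< r<l))

  SameCoset : Subset order → G → G → Set
  SameCoset U c c′ = (c + (- c′)) ∈G U

  -- w = (g,π) fixes the tabloid t, where (g,π)·(c,i) = (c + g_{π i}, π i)
  Fixes : W → (Fin n → Entry) → Set
  Fixes ⟨ g , π ⟩ t = ∀ i →
      sub (t (π ⟨$⟩ʳ i)) ≡ sub (t i)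
    × row (t (π ⟨$⟩ʳ i)) ≡ row (t i)
    × SameCoset (sub (t i)) (coset (t i) + g (π ⟨$⟩ʳ i)) (coset (t (π ⟨$⟩ʳ i)))

  -- C(σ) relative to H_σ = stabiliser of the fixed tabloid t₀
  InC : (Fin n → Entry) → (G → Par) → Set
  InC t₀ λ′ = ∃ λ w → Fixes w t₀ × InClass w λ′

  IsClique : (Subset order → Par) → List W → Set
  IsClique σ Y = ∀ {x y} → x ∈ Y → y ∈ Y → ¬ (x ≈W y) →
                 ∀ t → IsTabloid σ t → ¬ Fixes ((x ⁻¹) · y) t

  innerDist : List W → (G → Par) → ℚ
  innerDist [] λ′ = 0ℚ
  innerDist Y@(_ ∷ ys) λ′ =
    + length (filter (λ p → inClass? ((proj₁ p ⁻¹) · proj₂ p) λ′) (cartesianProduct Y Y))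
      / suc (length ys)

  1ⁿ : Par
  1ⁿ = replicate n 1

{-# OPTIONS --safe #-}
-- An element of W fixes some σ-tabloid iff its cycle type lies in C(σ).  W acts transitively on
-- σ-tabloids (match them box by box), and conjugating by x carries the stabiliser of a tabloid to
-- that of its x-image; so an element fixing any tabloid is conjugate into H_σ, and conjugation
-- preserves cycle types because it matches cycles and changes the group entries along a cycle by a
-- coboundary, whose sum around the cycle vanishes.  Conversely, elements of equal cycle type are
-- conjugate: match their cycles of equal length and sign point by point, and absorb the difference
-- of entries into the partial sums along each cycle, which close up since the cycle sums agree.
-- Finally the cycle type of x⁻¹y has λ(0) = (1ⁿ) only when x = y, so a_λ vanishes for all
-- λ ∈ C(σ) with λ(0) ≠ (1ⁿ) exactly when no x⁻¹y with x ≠ y in Y fixes a tabloid.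
module Submission where

open import Defs
open import Level using (0ℓ)
open import Algebra.Bundles using (AbelianGroup; CommutativeSemigroup)
open import Algebra.Structures using (IsAbelianGroup; IsCommutativeMonoid)
import Algebra.Properties.AbelianGroup as AbelianGroupProperties
import Algebra.Properties.CommutativeMonoid.Sum as MonoidSum
import Algebra.Properties.CommutativeSemigroup as CommutativeSemigroupProperties
open import Data.Bool using (Bool; true; false; _∧_; not; if_then_else_; T)
import Data.Bool
import Data.Bool.Properties as BoolP
open import Data.Empty using (⊥-elim)
open import Data.Fin using (Fin; zero; suc; toℕ; fromℕ<)
import Data.Fin.Properties as FinP
open import Data.Fin.Permutation using (Permutation′; _⟨$⟩ʳ_; _⟨$⟩ˡ_; _∘ₚ_; flip; permutation; inverseˡ; inverseʳ)
import Data.Fin.Permutation as Perm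
open import Data.Fin.Subset using (Subset)
import Data.Integer as ℤ
import Data.Integer.GCD as ℤGCD
import Data.Integer.Properties as ℤP
open import Data.List using (List; []; _∷_; _++_; replicate; length)
import Data.List.Properties as ListP
open import Data.List.Membership.Propositional using (_∈_; lose)
open import Data.List.Membership.Propositional.Properties using (∈-cartesianProduct⁺; ∈-cartesianProduct⁻)
open import Data.List.Relation.Unary.All using (All; []; _∷_)
import Data.List.Relation.Unary.All as All
import Data.List.Relation.Unary.All.Properties as AllP
open import Data.List.Relation.Unary.AllPairs using (AllPairs)
open import Data.List.Relation.Unary.Linked using (Linked; []; [-]; _∷_)
open import Data.Maybe using (Maybe; just; nothing; fromMaybe)
import Data.Maybe as Maybe
open import Data.Nat using (ℕ; zero; suc; _+_; _*_; _∸_; _≤_; _<_; _≥_; z≤n; s≤s; _≡ᵇ_; _<ᵇ_)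
import Data.Nat.Properties as ℕP
open import Data.Nat.DivMod using (_%_; _/_; m≡m%n+[m/n]*n; m%n<n; m*n/n≡m; n/1≡n; 0/n≡0)
open import Data.Nat.ListAction using (sum)
import Data.Nat.ListAction.Properties as ListSumP
open import Data.Product using (∃; _×_; _,_; proj₁; proj₂)
open import Data.Rational using (0ℚ; ↥_)
import Data.Rational as ℚ
import Data.Rational.Properties as ℚP
open import Data.Sum using (_⊎_; inj₁; inj₂)
import Data.Vec.Properties as VecP
open import Function using (_∘_; case_of_)
open import Function.Bundles using (Equivalence; Inverse; _⇔_; mk⇔)
open import Function.Definitions using (Injective)
open import Relation.Binary using (tri<; tri≈; tri>)
open import Relation.Binary.PropositionalEquality
open import Relation.Nullary using (¬_; Dec; yes; no; does; ⌊_⌋)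
open import Relation.Nullary.Decidable using (dec-true; dec-false)

private
  variable
    k : ℕ

  cong₃ : ∀ {A B C D : Set} (f : A → B → C → D) {a a′ b b′ c c′} → a ≡ a′ → b ≡ b′ → c ≡ c′ → f a b c ≡ f a′ b′ c′
  cong₃ f refl refl refl = refl

-- Counting over Fin

does≡true⇒ : {P : Set} (P? : Dec P) → does P? ≡ true → P
does≡true⇒ (yes p) _  = p
does≡true⇒ (no _)  ()

≡ᵇ≡true⇒≡ : ∀ {m n} → (m ≡ᵇ n) ≡ true → m ≡ n
≡ᵇ≡true⇒≡ {m} {n} e = ℕP.≡ᵇ⇒≡ m n (subst T (sym e) _)

≡⇒≡ᵇ≡true : ∀ {m n} → m ≡ n → (m ≡ᵇ n) ≡ true
≡⇒≡ᵇ≡true {m} {n} e = Equivalence.to BoolP.T-≡ (ℕP.≡⇒≡ᵇ m n e)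

⌊⌋≡true : {P : Set} (P? : Dec P) → P → ⌊ P? ⌋ ≡ true
⌊⌋≡true (yes _) _ = refl
⌊⌋≡true (no ¬p) p = ⊥-elim (¬p p)

⌊⌋≡false : {P : Set} (P? : Dec P) → ¬ P → ⌊ P? ⌋ ≡ false
⌊⌋≡false (yes p) ¬p = ⊥-elim (¬p p)
⌊⌋≡false (no _)  _  = refl

⌊⌋≡true⇒ : {P : Set} (P? : Dec P) → ⌊ P? ⌋ ≡ true → P
⌊⌋≡true⇒ (yes p) _ = p
⌊⌋≡true⇒ (no _)  ()

indicator : Bool → ℕ
indicator b = if b then 1 else 0

sumFin-cong : {f g : Fin k → ℕ} → (∀ i → f i ≡ g i) → sumFin f ≡ sumFin g
sumFin-cong {zero}  e = refl
sumFin-cong {suc k} e = cong₂ _+_ (e zero) (sumFin-cong (e ∘ suc))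

countFin-cong : {f g : Fin k → Bool} → (∀ i → f i ≡ g i) → countFin f ≡ countFin g
countFin-cong {zero}  e = refl
countFin-cong {suc k} e = cong₂ _+_ (cong indicator (e zero)) (countFin-cong (e ∘ suc))

countFin≡sumFin : (f : Fin k → Bool) → countFin f ≡ sumFin (indicator ∘ f)
countFin≡sumFin {zero}  f = refl
countFin≡sumFin {suc k} f = cong (indicator (f zero) +_) (countFin≡sumFin (f ∘ suc))

private
  module ∑ = MonoidSum ℕP.+-0-commutativeMonoid

  sumFin≡∑ : (f : Fin k → ℕ) → sumFin f ≡ ∑.sum f
  sumFin≡∑ {zero}  f = refl
  sumFin≡∑ {suc k} f = cong (f zero +_) (sumFin≡∑ (f ∘ suc))

sumFin-permute : (f : Fin k → ℕ) (ρ : Permutation′ k) → sumFin (f ∘ (ρ ⟨$⟩ʳ_)) ≡ sumFin f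
sumFin-permute f ρ = begin
  sumFin (f ∘ (ρ ⟨$⟩ʳ_)) ≡⟨ sumFin≡∑ (f ∘ (ρ ⟨$⟩ʳ_)) ⟩
  ∑.sum (f ∘ (ρ ⟨$⟩ʳ_))  ≡⟨ ∑.sum-permute f ρ ⟨
  ∑.sum f                ≡⟨ sumFin≡∑ f ⟨
  sumFin f               ∎
  where open ≡-Reasoning

countFin-permute : (f : Fin k → Bool) (ρ : Permutation′ k) → countFin (f ∘ (ρ ⟨$⟩ʳ_)) ≡ countFin f
countFin-permute f ρ = begin
  countFin (f ∘ (ρ ⟨$⟩ʳ_))          ≡⟨ countFin≡sumFin (f ∘ (ρ ⟨$⟩ʳ_)) ⟩
  sumFin (indicator ∘ f ∘ (ρ ⟨$⟩ʳ_)) ≡⟨ sumFin-permute (indicator ∘ f) ρ ⟩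
  sumFin (indicator ∘ f)            ≡⟨ countFin≡sumFin f ⟨
  countFin f                        ∎
  where open ≡-Reasoning

sumFin-swap : ∀ {a b} (F : Fin a → Fin b → ℕ) →
              sumFin (λ i → sumFin (F i)) ≡ sumFin (λ j → sumFin (λ i → F i j))
sumFin-swap F = begin
  sumFin (λ i → sumFin (F i))            ≡⟨ sumFin-cong (λ i → sumFin≡∑ (F i)) ⟩
  sumFin (λ i → ∑.sum (F i))             ≡⟨ sumFin≡∑ (λ i → ∑.sum (F i)) ⟩
  ∑.sum (λ i → ∑.sum (F i))              ≡⟨ ∑.∑-comm F ⟩
  ∑.sum (λ j → ∑.sum (λ i → F i j))      ≡⟨ sumFin≡∑ (λ j → ∑.sum (λ i → F i j)) ⟨
  sumFin (λ j → ∑.sum (λ i → F i j))     ≡⟨ sumFin-cong (λ j → sumFin≡∑ (λ i → F i j)) ⟨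
  sumFin (λ j → sumFin (λ i → F i j))    ∎
  where open ≡-Reasoning

sumFin-zero : (f : Fin k → ℕ) → (∀ i → f i ≡ 0) → sumFin f ≡ 0
sumFin-zero {zero}  f e = refl
sumFin-zero {suc k} f e = cong₂ _+_ (e zero) (sumFin-zero (f ∘ suc) (e ∘ suc))

sumFin-single : (f : Fin k → ℕ) (a : Fin k) → f a ≡ 1 → (∀ i → i ≢ a → f i ≡ 0) → sumFin f ≡ 1
sumFin-single f zero    fa e = cong₂ _+_ fa (sumFin-zero (f ∘ suc) (λ i → e (suc i) λ ()))
sumFin-single f (suc a) fa e =
  trans (cong (_+ sumFin (f ∘ suc)) (e zero (λ ())))
        (sumFin-single (f ∘ suc) a fa (λ i i≢a → e (suc i) (i≢a ∘ FinP.suc-injective)))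

sumFin-const : ∀ c → sumFin {k} (λ _ → c) ≡ k * c
sumFin-const {zero}  c = refl
sumFin-const {suc k} c = cong (c +_) (sumFin-const {k} c)

countFin-none : (f : Fin k → Bool) → (∀ i → f i ≡ false) → countFin f ≡ 0
countFin-none {zero}  f e = refl
countFin-none {suc k} f e rewrite e zero = countFin-none (f ∘ suc) (e ∘ suc)

countFin-all : (f : Fin k → Bool) → (∀ i → f i ≡ true) → countFin f ≡ k
countFin-all {zero}  f e = refl
countFin-all {suc k} f e rewrite e zero = cong suc (countFin-all (f ∘ suc) (e ∘ suc))

countFin-≤ : (f : Fin k → Bool) → countFin f ≤ k
countFin-≤ {zero}  f = z≤n
countFin-≤ {suc k} f with f zero
... | true  = s≤s (countFin-≤ (f ∘ suc))
... | false = ℕP.m≤n⇒m≤1+n (countFin-≤ (f ∘ suc))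

countFin≡k⇒all : (f : Fin k → Bool) → countFin f ≡ k → ∀ i → f i ≡ true
countFin≡k⇒all {suc k} f e i with f zero in f0
countFin≡k⇒all {suc k} f e zero    | true  = f0
countFin≡k⇒all {suc k} f e (suc i) | true  = countFin≡k⇒all (f ∘ suc) (ℕP.suc-injective e) i
countFin≡k⇒all {suc k} f e i       | false =
  ⊥-elim (ℕP.n≮n k (subst (_≤ k) e (countFin-≤ (f ∘ suc))))

countFin-split : (f g : Fin k → Bool) →
                 countFin f ≡ countFin (λ i → f i ∧ g i) + countFin (λ i → f i ∧ not (g i))
countFin-split {zero}  f g = refl
countFin-split {suc k} f g with f zero | g zero
... | true  | true  = cong suc (countFin-split (f ∘ suc) (g ∘ suc))
... | true  | false = trans (cong suc (countFin-split (f ∘ suc) (g ∘ suc))) (sym (ℕP.+-suc _ _))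
... | false | _     = countFin-split (f ∘ suc) (g ∘ suc)

module SumBelow {A : Set} {_∙_ : A → A → A} {ε : A} (isCM : IsCommutativeMonoid _≡_ _∙_ ε) where
  open IsCommutativeMonoid isCM using (assoc; comm; identityˡ; identityʳ; isCommutativeSemigroup)

  private
    commutativeSemigroup : CommutativeSemigroup 0ℓ 0ℓ
    commutativeSemigroup = record { isCommutativeSemigroup = isCommutativeSemigroup }

  open CommutativeSemigroupProperties commutativeSemigroup using (interchange)

  sumBelow : ℕ → (ℕ → A) → A
  sumBelow zero    a = ε
  sumBelow (suc L) a = a L ∙ sumBelow L a

  sumBelow-unique : (a F : ℕ → A) → F 0 ≡ ε → (∀ k → F (suc k) ≡ a k ∙ F k) → ∀ L → F L ≡ sumBelow L a
  sumBelow-unique a F F0 Fsuc zero    = F0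
  sumBelow-unique a F F0 Fsuc (suc L) = trans (Fsuc L) (cong (a L ∙_) (sumBelow-unique a F F0 Fsuc L))

  sumBelow-cong : ∀ L {a b : ℕ → A} → (∀ k → k < L → a k ≡ b k) → sumBelow L a ≡ sumBelow L b
  sumBelow-cong zero    e = refl
  sumBelow-cong (suc L) e = cong₂ _∙_ (e L ℕP.≤-refl) (sumBelow-cong L (λ k k<L → e k (ℕP.m<n⇒m<1+n k<L)))

  sumBelow-∙ : ∀ L (a b : ℕ → A) → sumBelow L (λ k → a k ∙ b k) ≡ sumBelow L a ∙ sumBelow L b
  sumBelow-∙ zero    a b = sym (identityˡ ε)
  sumBelow-∙ (suc L) a b = begin
    (a L ∙ b L) ∙ sumBelow L (λ k → a k ∙ b k)  ≡⟨ cong ((a L ∙ b L) ∙_) (sumBelow-∙ L a b) ⟩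
    (a L ∙ b L) ∙ (sumBelow L a ∙ sumBelow L b) ≡⟨ interchange (a L) (b L) (sumBelow L a) (sumBelow L b) ⟩
    (a L ∙ sumBelow L a) ∙ (b L ∙ sumBelow L b) ∎
    where open ≡-Reasoning

  sumBelow-shift : ∀ L (a : ℕ → A) → sumBelow L (a ∘ suc) ∙ a 0 ≡ sumBelow (suc L) a
  sumBelow-shift zero    a = trans (identityˡ (a 0)) (sym (identityʳ (a 0)))
  sumBelow-shift (suc L) a = trans (assoc (a (suc L)) _ (a 0)) (cong (a (suc L) ∙_) (sumBelow-shift L a))

  sumBelow-rotate : ∀ L (a : ℕ → A) → a L ≡ a 0 → sumBelow L (a ∘ suc) ≡ sumBelow L a
  sumBelow-rotate zero    a _      = refl
  sumBelow-rotate (suc L) a period = begin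
    a (suc L) ∙ sumBelow L (a ∘ suc) ≡⟨ cong (_∙ sumBelow L (a ∘ suc)) period ⟩
    a 0 ∙ sumBelow L (a ∘ suc)       ≡⟨ comm (a 0) _ ⟩
    sumBelow L (a ∘ suc) ∙ a 0       ≡⟨ sumBelow-shift L a ⟩
    sumBelow (suc L) a               ∎
    where open ≡-Reasoning

open SumBelow ℕP.+-0-isCommutativeMonoid public using () renaming (sumBelow to sumBelowℕ; sumBelow-cong to sumBelowℕ-cong)

sumBelowℕ-const : ∀ L (a : ℕ → ℕ) c → (∀ d → d < L → a d ≡ c) → sumBelowℕ L a ≡ L * c
sumBelowℕ-const zero    a c e = refl
sumBelowℕ-const (suc L) a c e =
  cong₂ _+_ (e L ℕP.≤-refl) (sumBelowℕ-const L a c (λ d d<L → e d (ℕP.m<n⇒m<1+n d<L)))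

countFin-fibres : ∀ M (f : Fin k → Bool) (v : Fin k → ℕ) → (∀ i → f i ≡ true → v i < M) →
                  countFin f ≡ sumBelowℕ M (λ d → countFin (λ i → f i ∧ (v i ≡ᵇ d)))
countFin-fibres M f v bounded = trans (countFin-cong restrict) (fibres M)
  where
  restrict : ∀ i → f i ≡ (f i ∧ (v i <ᵇ M))
  restrict i with f i in fi
  ... | false = refl
  ... | true  = sym (Equivalence.to BoolP.T-≡ (ℕP.<⇒<ᵇ (bounded i fi)))

  <ᵇ-suc-∧-≡ᵇ : ∀ x M → ((x <ᵇ suc M) ∧ (x ≡ᵇ M)) ≡ (x ≡ᵇ M)
  <ᵇ-suc-∧-≡ᵇ zero    zero    = refl
  <ᵇ-suc-∧-≡ᵇ zero    (suc M) = refl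
  <ᵇ-suc-∧-≡ᵇ (suc x) zero    = refl
  <ᵇ-suc-∧-≡ᵇ (suc x) (suc M) = <ᵇ-suc-∧-≡ᵇ x M

  <ᵇ-suc-∧-≢ᵇ : ∀ x M → ((x <ᵇ suc M) ∧ not (x ≡ᵇ M)) ≡ (x <ᵇ M)
  <ᵇ-suc-∧-≢ᵇ zero    zero    = refl
  <ᵇ-suc-∧-≢ᵇ zero    (suc M) = refl
  <ᵇ-suc-∧-≢ᵇ (suc x) zero    = refl
  <ᵇ-suc-∧-≢ᵇ (suc x) (suc M) = <ᵇ-suc-∧-≢ᵇ x M

  fibres : ∀ M → countFin (λ i → f i ∧ (v i <ᵇ M)) ≡ sumBelowℕ M (λ d → countFin (λ i → f i ∧ (v i ≡ᵇ d)))
  fibres zero    = countFin-none _ (λ i → BoolP.∧-zeroʳ (f i))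
  fibres (suc M) = trans (countFin-split (λ i → f i ∧ (v i <ᵇ suc M)) (λ i → v i ≡ᵇ M)) (cong₂ _+_
    (countFin-cong (λ i → trans (BoolP.∧-assoc (f i) _ _) (cong (f i ∧_) (<ᵇ-suc-∧-≡ᵇ (v i) M))))
    (trans (countFin-cong (λ i → trans (BoolP.∧-assoc (f i) _ _) (cong (f i ∧_) (<ᵇ-suc-∧-≢ᵇ (v i) M))))
           (fibres M)))

rank : (P : Fin k → Bool) → Fin k → ℕ
rank P i = countFin (λ j → (toℕ j <ᵇ toℕ i) ∧ P j)

rank-zero : (P : Fin (suc k) → Bool) → rank P zero ≡ 0
rank-zero P = countFin-none (λ j → (toℕ j <ᵇ 0) ∧ P j) (λ _ → refl)

rank-< : (P : Fin k → Bool) {i : Fin k} → P i ≡ true → rank P i < countFin P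
rank-< P {zero} Pi rewrite rank-zero P | Pi = s≤s z≤n
rank-< P {suc i} Pi with P zero
... | true  = s≤s (rank-< (P ∘ suc) Pi)
... | false = rank-< (P ∘ suc) Pi

rank-injective : (P : Fin k → Bool) {i i′ : Fin k} → P i ≡ true → P i′ ≡ true → rank P i ≡ rank P i′ → i ≡ i′
rank-injective P {zero}  {zero}   _  _   _ = refl
rank-injective P {zero}  {suc i′} P0 _   r rewrite rank-zero P with P zero
rank-injective P {zero}  {suc i′} P0 _   () | true
rank-injective P {zero}  {suc i′} () _   r  | false
rank-injective P {suc i} {zero}   _  P0  r rewrite rank-zero P with P zero
rank-injective P {suc i} {zero}   _  P0  () | true
rank-injective P {suc i} {zero}   _  ()  r  | false
rank-injective P {suc i} {suc i′} Pi Pi′ r with P zero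
... | true  = cong suc (rank-injective (P ∘ suc) Pi Pi′ (ℕP.suc-injective r))
... | false = cong suc (rank-injective (P ∘ suc) Pi Pi′ r)

rank-surjective : (P : Fin k → Bool) {r : ℕ} → r < countFin P → ∃ λ i → P i ≡ true × rank P i ≡ r
rank-surjective {zero}  P ()
rank-surjective {suc k} P {r} r< with P zero in P0
rank-surjective {suc k} P {zero}  r<       | true  = zero , P0 , rank-zero P
rank-surjective {suc k} P {suc r} (s≤s r<) | true  =
  let i , Pi , ri = rank-surjective (P ∘ suc) r< in suc i , Pi , cong suc ri
rank-surjective {suc k} P {r}     r<       | false =
  let i , Pi , ri = rank-surjective (P ∘ suc) r< in suc i , Pi , ri

permutationMatchingKeys :
  {K : Set} (key₁ key₂ : Fin k → K) → Injective _≡_ _≡_ key₁ → Injective _≡_ _≡_ key₂ →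
  (∀ i → ∃ λ j → key₂ j ≡ key₁ i) → (∀ j → ∃ λ i → key₁ i ≡ key₂ j) →
  ∃ λ (ρ : Permutation′ k) → ∀ i → key₂ (ρ ⟨$⟩ʳ i) ≡ key₁ i
permutationMatchingKeys key₁ key₂ injective₁ injective₂ img₁ img₂ =
  permutation (proj₁ ∘ img₁) (proj₁ ∘ img₂)
    (λ j → injective₂ (trans (proj₂ (img₁ (proj₁ (img₂ j)))) (proj₂ (img₂ j))))
    (λ i → injective₁ (trans (proj₂ (img₂ (proj₁ (img₁ i)))) (proj₂ (img₁ i))))
  , proj₂ ∘ img₁

firstTrue : (Fin k → Bool) → Maybe (Fin k)
firstTrue {zero}  P = nothing
firstTrue {suc k} P = if P zero then just zero else Maybe.map suc (firstTrue (P ∘ suc))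

firstTrue-cong : {P Q : Fin k → Bool} → (∀ x → P x ≡ Q x) → firstTrue P ≡ firstTrue Q
firstTrue-cong {zero}  e = refl
firstTrue-cong {suc k} e =
  cong₂ (λ b m → if b then just zero else Maybe.map suc m) (e zero) (firstTrue-cong (e ∘ suc))

firstTrue-just : (P : Fin k → Bool) {x : Fin k} → P x ≡ true → ∃ λ y → firstTrue P ≡ just y × P y ≡ true
firstTrue-just {suc k} P {x} Px with P zero in P0
... | true = zero , refl , P0
firstTrue-just {suc k} P {zero}  Px | false = case trans (sym P0) Px of λ ()
firstTrue-just {suc k} P {suc x} Px | false =
  let y , first≡y , Py = firstTrue-just (P ∘ suc) Px in suc y , cong (Maybe.map suc) first≡y , Py

-- Orbits of a permutation

module _ (𝔾 : FinAbGroup) where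
  private
    iter : ∀ {N} → Permutation′ N → ℕ → Fin N → Fin N
    iter {N} = Wreath.iter 𝔾 N

  mutual
    firstReturnFrom : ∀ {N} (π : Permutation′ N) (i : Fin N) (f k : ℕ) → ℕ
    firstReturnFrom π i zero    k = k
    firstReturnFrom π i (suc f) k = firstReturnStep π i f k (iter π k i FinP.≟ i)

    firstReturnStep : ∀ {N} (π : Permutation′ N) (i : Fin N) (f k : ℕ) → Dec (iter π k i ≡ i) → ℕ
    firstReturnStep π i f k (yes _) = k
    firstReturnStep π i f k (no _)  = firstReturnFrom π i f (suc k)

  private
    StepFunction : Set
    StepFunction = ∀ N (π : Permutation′ N) i (f k : ℕ) → Dec (iter π k i ≡ i) → ℕ

    firstReturnStep-unique :
      (H : StepFunction) →
      (∀ N π i f k p → H N π i f k (yes p) ≡ k) →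
      (∀ N π i k q → H N π i zero k (no q) ≡ suc k) →
      (∀ N π i f k q → H N π i (suc f) k (no q) ≡ H N π i f (suc k) (iter π (suc k) i FinP.≟ i)) →
      ∀ N π i f k d → H N π i f k d ≡ firstReturnStep π i f k d
    firstReturnStep-unique H yes≡ no-zero≡ no-suc≡ N π i f       k (yes p) = yes≡ N π i f k p
    firstReturnStep-unique H yes≡ no-zero≡ no-suc≡ N π i zero    k (no q)  = no-zero≡ N π i k q
    firstReturnStep-unique H yes≡ no-zero≡ no-suc≡ N π i (suc f) k (no q)  =
      trans (no-suc≡ N π i f k q) (firstReturnStep-unique H yes≡ no-zero≡ no-suc≡ N π i f (suc k) _)

  -- cycLen searches through a with-function local to Defs, which cannot be named here.  Generalising
  -- the goal makes all its arguments distinct variables, so that function becomes the solution of the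
  -- metavariable `_` below, and its defining equations hold by refl.
  cycLen≡firstReturnFrom : ∀ N (π : Permutation′ N) i → Wreath.cycLen 𝔾 N π i ≡ firstReturnFrom π i N 1
  cycLen≡firstReturnFrom (suc m) π i
    with firstReturnStep-unique _ (λ _ _ _ _ _ _ → refl) (λ _ _ _ _ _ → refl) (λ _ _ _ _ _ _ → refl)
       | m | suc m | π | i
  ... | unique | f | N | π′ | i′ with iter π′ 1 i′ FinP.≟ i′
  ...   | yes _ = refl
  ...   | no _ with 2
  ...     | k with f
  ...       | zero   = refl
  ...       | suc f′ with iter π′ k i′ FinP.≟ i′
  ...         | d = unique N π′ i′ f′ k d

module Orbits (𝔾 : FinAbGroup) {n : ℕ} (π : Permutation′ n) where
  iter : ℕ → Fin n → Fin n
  iter = Wreath.iter 𝔾 n π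

  cycLen : Fin n → ℕ
  cycLen = Wreath.cycLen 𝔾 n π

  iter-+ : ∀ a b i → iter (a + b) i ≡ iter a (iter b i)
  iter-+ zero    b i = refl
  iter-+ (suc a) b i = cong (π ⟨$⟩ʳ_) (iter-+ a b i)

  iter-comm : ∀ a b i → iter a (iter b i) ≡ iter b (iter a i)
  iter-comm a b i = trans (sym (iter-+ a b i)) (trans (cong (λ x → iter x i) (ℕP.+-comm a b)) (iter-+ b a i))

  iter-suc : ∀ k i → iter (suc k) i ≡ iter k (π ⟨$⟩ʳ i)
  iter-suc k i = trans (cong (λ x → iter x i) (ℕP.+-comm 1 k)) (iter-+ k 1 i)

  iter-injective : ∀ a {x y} → iter a x ≡ iter a y → x ≡ y
  iter-injective zero    e = e
  iter-injective (suc a) e = iter-injective a (trans (sym (inverseˡ π)) (trans (cong (π ⟨$⟩ˡ_) e) (inverseˡ π)))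

  iter-*-period : ∀ L i → iter L i ≡ i → ∀ q → iter (q * L) i ≡ i
  iter-*-period L i period zero    = refl
  iter-*-period L i period (suc q) = trans (iter-+ L (q * L) i) (trans (cong (iter L) (iter-*-period L i period q)) period)

  -- two of the points i, π i, …, πⁿ i coincide, and π is injective
  period-≤n : ∀ i → ∃ λ p → 1 ≤ p × p ≤ n × iter p i ≡ i
  period-≤n i with FinP.pigeonhole (ℕP.n<1+n n) (λ (d : Fin (suc n)) → iter (toℕ d) i)
  ... | a , b , a<b , iterₐ≡iterᵦ = toℕ b ∸ toℕ a , ℕP.m<n⇒0<n∸m a<b ,
        ℕP.≤-trans (ℕP.m∸n≤m (toℕ b) (toℕ a)) (ℕP.≤-pred (FinP.toℕ<n b)) ,
        iter-injective (toℕ a) (begin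
          iter (toℕ a) (iter (toℕ b ∸ toℕ a) i) ≡⟨ iter-comm (toℕ a) (toℕ b ∸ toℕ a) i ⟩
          iter (toℕ b ∸ toℕ a) (iter (toℕ a) i) ≡⟨ iter-+ (toℕ b ∸ toℕ a) (toℕ a) i ⟨
          iter (toℕ b ∸ toℕ a + toℕ a) i        ≡⟨ cong (λ x → iter x i) (ℕP.m∸n+n≡m (ℕP.<⇒≤ a<b)) ⟩
          iter (toℕ b) i                        ≡⟨ iterₐ≡iterᵦ ⟨
          iter (toℕ a) i                        ∎)
    where open ≡-Reasoning

  IsCycleLength : Fin n → ℕ → Set
  IsCycleLength i L = 1 ≤ L × iter L i ≡ i × (∀ j → 1 ≤ j → j < L → iter j i ≢ i)

  private
    FirstReturnFrom : Fin n → ℕ → ℕ → ℕ → Set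
    FirstReturnFrom i f k R = k ≤ R × (∀ j → k ≤ j → j < R → iter j i ≢ i) × (R < f + k → iter R i ≡ i)

    firstReturnFrom-spec : ∀ i f k → FirstReturnFrom i f k (firstReturnFrom 𝔾 π i f k)
    firstReturnFrom-spec i zero    k = ℕP.≤-refl , (λ j k≤j j<k _ → ℕP.<⇒≱ j<k k≤j) , (λ k<k → ⊥-elim (ℕP.<-irrefl refl k<k))
    firstReturnFrom-spec i (suc f) k with iter k i FinP.≟ i
    ... | yes returned = ℕP.≤-refl , (λ j k≤j j<k _ → ℕP.<⇒≱ j<k k≤j) , (λ _ → returned)
    ... | no ¬returned = ℕP.<⇒≤ k<R , notBefore , (λ R<f+k → fixed (subst (R <_) (sym (ℕP.+-suc f k)) R<f+k))
      where
      R : ℕ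
      R = firstReturnFrom 𝔾 π i f (suc k)
      spec : FirstReturnFrom i f (suc k) R
      spec = firstReturnFrom-spec i f (suc k)
      k<R : k < R
      k<R = proj₁ spec
      fixed : R < f + suc k → iter R i ≡ i
      fixed = proj₂ (proj₂ spec)
      notBefore : ∀ j → k ≤ j → j < R → iter j i ≢ i
      notBefore j k≤j j<R with ℕP.m≤n⇒m<n∨m≡n k≤j
      ... | inj₁ k<j  = proj₁ (proj₂ spec) j k<j j<R
      ... | inj₂ refl = ¬returned

  cycLen-isCycleLength : ∀ i → IsCycleLength i (cycLen i)
  cycLen-isCycleLength i rewrite cycLen≡firstReturnFrom 𝔾 n π i =
    let 1≤R , notBefore , fixed = firstReturnFrom-spec i n 1
        p , 1≤p , p≤n , p-period = period-≤n i
        R≤p = ℕP.≮⇒≥ (λ p<R → notBefore p 1≤p p<R p-period)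
    in 1≤R , fixed (subst (firstReturnFrom 𝔾 π i n 1 <_) (ℕP.+-comm 1 n) (s≤s (ℕP.≤-trans R≤p p≤n))) , notBefore

  cycLen-pos : ∀ i → 1 ≤ cycLen i
  cycLen-pos i = proj₁ (cycLen-isCycleLength i)

  iter-cycLen : ∀ i → iter (cycLen i) i ≡ i
  iter-cycLen i = proj₁ (proj₂ (cycLen-isCycleLength i))

  cycLen-minimal : ∀ i j → 1 ≤ j → j < cycLen i → iter j i ≢ i
  cycLen-minimal i = proj₂ (proj₂ (cycLen-isCycleLength i))

  cycLen-≤ : ∀ i → cycLen i ≤ n
  cycLen-≤ i = let p , 1≤p , p≤n , p-period = period-≤n i
               in ℕP.≤-trans (ℕP.≮⇒≥ (λ p<L → cycLen-minimal i p 1≤p p<L p-period)) p≤n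

  cycLen-unique : ∀ i L → IsCycleLength i L → cycLen i ≡ L
  cycLen-unique i L (1≤L , L-period , L-minimal) with ℕP.<-cmp (cycLen i) L
  ... | tri< lt _ _ = ⊥-elim (L-minimal (cycLen i) (cycLen-pos i) lt (iter-cycLen i))
  ... | tri≈ _ eq _ = eq
  ... | tri> _ _ gt = ⊥-elim (cycLen-minimal i L 1≤L gt L-period)

  iter-distinct-<cycLen : ∀ i {a b} → a < b → b < cycLen i → iter a i ≢ iter b i
  iter-distinct-<cycLen i {a} {b} a<b b<L eq = cycLen-minimal i (b ∸ a) (ℕP.m<n⇒0<n∸m a<b)
    (ℕP.≤-<-trans (ℕP.m∸n≤m b a) b<L)
    (iter-injective a (begin
      iter a (iter (b ∸ a) i) ≡⟨ iter-comm a (b ∸ a) i ⟩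
      iter (b ∸ a) (iter a i) ≡⟨ iter-+ (b ∸ a) a i ⟨
      iter (b ∸ a + a) i      ≡⟨ cong (λ x → iter x i) (ℕP.m∸n+n≡m (ℕP.<⇒≤ a<b)) ⟩
      iter b i                ≡⟨ eq ⟨
      iter a i                ∎))
    where open ≡-Reasoning

  iter-injective-<cycLen : ∀ i {a b} → a < cycLen i → b < cycLen i → iter a i ≡ iter b i → a ≡ b
  iter-injective-<cycLen i {a} {b} a<L b<L eq with ℕP.<-cmp a b
  ... | tri< a<b _ _ = ⊥-elim (iter-distinct-<cycLen i a<b b<L eq)
  ... | tri≈ _ a≡b _ = a≡b
  ... | tri> _ _ b<a = ⊥-elim (iter-distinct-<cycLen i b<a a<L (sym eq))

  cycLen-iter : ∀ d i → cycLen (iter d i) ≡ cycLen i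
  cycLen-iter d i = cycLen-unique (iter d i) (cycLen i)
    ( cycLen-pos i
    , trans (iter-comm (cycLen i) d i) (cong (iter d) (iter-cycLen i))
    , λ j 1≤j j<L returns → cycLen-minimal i j 1≤j j<L (iter-injective d (trans (iter-comm d j i) returns)))

  iter-mod : ∀ i d → ∃ λ r → r < cycLen i × iter r i ≡ iter d i
  iter-mod i d with cycLen i | cycLen-pos i | iter-cycLen i
  ... | suc L | _ | period = d % suc L , m%n<n d (suc L) , sym (begin
    iter d i                                     ≡⟨ cong (λ x → iter x i) (m≡m%n+[m/n]*n d (suc L)) ⟩
    iter (d % suc L + d / suc L * suc L) i       ≡⟨ iter-+ (d % suc L) (d / suc L * suc L) i ⟩
    iter (d % suc L) (iter (d / suc L * suc L) i) ≡⟨ cong (iter (d % suc L)) (iter-*-period (suc L) i period (d / suc L)) ⟩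
    iter (d % suc L) i                           ∎)
    where open ≡-Reasoning

  SameCycle : Fin n → Fin n → Set
  SameCycle i j = ∃ λ d → iter d i ≡ j

  sameCycle-bounded : ∀ {i j} → SameCycle i j → ∃ λ d → d < cycLen i × iter d i ≡ j
  sameCycle-bounded {i} (d , iterᵈ≡j) = let r , r<L , iterʳ≡iterᵈ = iter-mod i d in r , r<L , trans iterʳ≡iterᵈ iterᵈ≡j

  sameCycle-trans : ∀ {i j k} → SameCycle i j → SameCycle j k → SameCycle i k
  sameCycle-trans {i} (d₁ , e₁) (d₂ , e₂) = d₂ + d₁ , trans (iter-+ d₂ d₁ i) (trans (cong (iter d₂) e₁) e₂)

  sameCycle-sym : ∀ {i j} → SameCycle i j → SameCycle j i
  sameCycle-sym {i} {j} i~j =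
    let d , d<L , iterᵈ≡j = sameCycle-bounded i~j
    in cycLen i ∸ d , (begin
      iter (cycLen i ∸ d) j            ≡⟨ cong (iter (cycLen i ∸ d)) iterᵈ≡j ⟨
      iter (cycLen i ∸ d) (iter d i)   ≡⟨ iter-+ (cycLen i ∸ d) d i ⟨
      iter (cycLen i ∸ d + d) i        ≡⟨ cong (λ x → iter x i) (ℕP.m∸n+n≡m (ℕP.<⇒≤ d<L)) ⟩
      iter (cycLen i) i                ≡⟨ iter-cycLen i ⟩
      i                                ∎)
    where open ≡-Reasoning

  sameCycle? : ∀ i j → Dec (SameCycle i j)
  sameCycle? i j with FinP.any? (λ (d : Fin n) → iter (toℕ d) i FinP.≟ j)
  ... | yes (d , e) = yes (toℕ d , e)
  ... | no ¬found   = no λ i~j →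
    let d , d<L , iterᵈ≡j = sameCycle-bounded i~j
        d<n = ℕP.<-≤-trans d<L (cycLen-≤ i)
    in ¬found (fromℕ< d<n , trans (cong (λ x → iter x i) (FinP.toℕ-fromℕ< d<n)) iterᵈ≡j)

  private
    inCycleOf : Fin n → Fin n → Bool
    inCycleOf i j = does (sameCycle? i j)

    inCycleOf-complete : ∀ {i j} → SameCycle i j → inCycleOf i j ≡ true
    inCycleOf-complete {i} {j} i~j with sameCycle? i j
    ... | yes _   = refl
    ... | no i≁j = ⊥-elim (i≁j i~j)

    inCycleOf-sound : ∀ {i j} → inCycleOf i j ≡ true → SameCycle i j
    inCycleOf-sound {i} {j} _ with sameCycle? i j
    ... | yes i~j = i~j

    inCycleOf-cong : ∀ {i i′} → SameCycle i i′ → ∀ x → inCycleOf i x ≡ inCycleOf i′ x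
    inCycleOf-cong {i} {i′} i~i′ x with sameCycle? i x | sameCycle? i′ x
    ... | yes _   | yes _    = refl
    ... | no _    | no _     = refl
    ... | yes i~x | no i′≁x = ⊥-elim (i′≁x (sameCycle-trans (sameCycle-sym i~i′) i~x))
    ... | no i≁x  | yes i′~x = ⊥-elim (i≁x (sameCycle-trans i~i′ i′~x))

  -- the first point of the cycle through i (the default i is never used)
  base : Fin n → Fin n
  base i = fromMaybe i (firstTrue (inCycleOf i))

  sameCycle-base : ∀ i → SameCycle i (base i)
  sameCycle-base i with firstTrue-just (inCycleOf i) (inCycleOf-complete (0 , refl))
  ... | y , first≡y , i~y rewrite first≡y = inCycleOf-sound i~y

  base-cong : ∀ {i i′} → SameCycle i i′ → base i ≡ base i′
  base-cong {i} {i′} i~i′ with firstTrue-just (inCycleOf i) (inCycleOf-complete (0 , refl))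
  ... | y , first≡y , _ = begin
    fromMaybe i (firstTrue (inCycleOf i))   ≡⟨ cong (fromMaybe i) first≡y ⟩
    y                                       ≡⟨ cong (fromMaybe i′) (trans (sym (firstTrue-cong (inCycleOf-cong i~i′))) first≡y) ⟨
    fromMaybe i′ (firstTrue (inCycleOf i′)) ∎
    where open ≡-Reasoning

  base-iter : ∀ d i → base (iter d i) ≡ base i
  base-iter d i = sym (base-cong (d , refl))

  base-idempotent : ∀ i → base (base i) ≡ base i
  base-idempotent i = sym (base-cong (sameCycle-base i))

  cycLen-base : ∀ i → cycLen (base i) ≡ cycLen i
  cycLen-base i = let d , iterᵈ≡base = sameCycle-base i in trans (cong cycLen (sym iterᵈ≡base)) (cycLen-iter d i)

  private
    depthWitness : ∀ i → ∃ λ d → d < cycLen (base i) × iter d (base i) ≡ i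
    depthWitness i = sameCycle-bounded (sameCycle-sym (sameCycle-base i))

  depth : Fin n → ℕ
  depth i = proj₁ (depthWitness i)

  depth-< : ∀ i → depth i < cycLen i
  depth-< i = subst (depth i <_) (cycLen-base i) (proj₁ (proj₂ (depthWitness i)))

  iter-depth : ∀ i → iter (depth i) (base i) ≡ i
  iter-depth i = proj₂ (proj₂ (depthWitness i))

  depth-unique : ∀ i d → d < cycLen i → iter d (base i) ≡ i → d ≡ depth i
  depth-unique i d d<L iterᵈ≡i = iter-injective-<cycLen (base i)
    (subst (d <_) (sym (cycLen-base i)) d<L) (subst (depth i <_) (sym (cycLen-base i)) (depth-< i))
    (trans iterᵈ≡i (sym (iter-depth i)))

  depth≡0⇒base≡ : ∀ i → depth i ≡ 0 → base i ≡ i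
  depth≡0⇒base≡ i depth≡0 = trans (cong (λ x → iter x (base i)) (sym depth≡0)) (iter-depth i)

  base≡⇒depth≡0 : ∀ i → base i ≡ i → depth i ≡ 0
  base≡⇒depth≡0 i base≡i = sym (depth-unique i 0 (cycLen-pos i) base≡i)

  depth-base : ∀ i → depth (base i) ≡ 0
  depth-base i = base≡⇒depth≡0 (base i) (base-idempotent i)

  depth-iter-base : ∀ b d → depth b ≡ 0 → d < cycLen b → depth (iter d b) ≡ d
  depth-iter-base b d depth≡0 d<L = sym (depth-unique (iter d b) d (subst (d <_) (sym (cycLen-iter d b)) d<L)
    (cong (iter d) (trans (base-iter d b) (depth≡0⇒base≡ b depth≡0))))

  depth-step : ∀ i → (suc (depth i) < cycLen i × depth (π ⟨$⟩ʳ i) ≡ suc (depth i))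
                   ⊎ (suc (depth i) ≡ cycLen i × depth (π ⟨$⟩ʳ i) ≡ 0)
  depth-step i with ℕP.m≤n⇒m<n∨m≡n (depth-< i)
  ... | inj₁ sd<L = inj₁ (sd<L , sym (depth-unique (π ⟨$⟩ʳ i) (suc (depth i))
                     (subst (suc (depth i) <_) (sym (cycLen-iter 1 i)) sd<L)
                     (cong (π ⟨$⟩ʳ_) (trans (cong (iter (depth i)) (base-iter 1 i)) (iter-depth i)))))
  ... | inj₂ sd≡L = inj₂ (sd≡L , base≡⇒depth≡0 (π ⟨$⟩ʳ i) (sym (begin
    π ⟨$⟩ʳ i                              ≡⟨ cong (π ⟨$⟩ʳ_) (iter-depth i) ⟨
    iter (suc (depth i)) (base i)         ≡⟨ cong (λ x → iter x (base i)) (trans sd≡L (sym (cycLen-base i))) ⟩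
    iter (cycLen (base i)) (base i)       ≡⟨ iter-cycLen (base i) ⟩
    base i                                ≡⟨ base-iter 1 i ⟨
    base (π ⟨$⟩ʳ i)                       ∎)))
    where open ≡-Reasoning

-- Sums along cycles and conjugacy

module GroupLemmas (𝔾 : FinAbGroup) where
  open FinAbGroup 𝔾 renaming (_+_ to _⊕_; -_ to ⊝_)
  open IsAbelianGroup isAbelianGroup using (assoc; comm; isCommutativeMonoid)

  abelianGroup : AbelianGroup 0ℓ 0ℓ
  abelianGroup = record { isAbelianGroup = isAbelianGroup }

  open AbelianGroupProperties abelianGroup public
    using (∙-cancelˡ; ⁻¹-∙-comm; ⁻¹-involutive; //-rightDividesˡ; inverseʳ-unique)
  open SumBelow isCommutativeMonoid public

  infixl 6 _⊖_
  _⊖_ : Carrier → Carrier → Carrier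
  x ⊖ y = x ⊕ (⊝ y)

  sumBelow-neg : ∀ L (a : ℕ → Carrier) → sumBelow L (λ k → ⊝ a k) ≡ ⊝ sumBelow L a
  sumBelow-neg zero    a = sym (ε⁻¹≈ε)
    where open AbelianGroupProperties abelianGroup using (ε⁻¹≈ε)
  sumBelow-neg (suc L) a = trans (cong (⊝ a L ⊕_) (sumBelow-neg L a)) (⁻¹-∙-comm (a L) (sumBelow L a))

  sumBelow-⊖ : ∀ L (a b : ℕ → Carrier) → sumBelow L (λ k → a k ⊖ b k) ≡ sumBelow L a ⊖ sumBelow L b
  sumBelow-⊖ L a b = trans (sumBelow-∙ L a (λ k → ⊝ b k)) (cong (sumBelow L a ⊕_) (sumBelow-neg L b))

  x⊖x≡0 : ∀ x → x ⊖ x ≡ 0#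
  x⊖x≡0 = IsAbelianGroup.inverseʳ isAbelianGroup

  x⊖y⊕y≡x : ∀ x y → x ⊖ y ⊕ y ≡ x
  x⊖y⊕y≡x x y = //-rightDividesˡ y x

  y⊕[x⊖y]≡x : ∀ x y → y ⊕ (x ⊖ y) ≡ x
  y⊕[x⊖y]≡x x y = trans (comm y (x ⊖ y)) (x⊖y⊕y≡x x y)

  ⊝x⊕y≡0⇒x≡y : ∀ x y → ⊝ x ⊕ y ≡ 0# → x ≡ y
  ⊝x⊕y≡0⇒x≡y x y e = trans (sym (⁻¹-involutive x)) (sym (inverseʳ-unique (⊝ x) y e))

  x⊕y≡x⊕z⇒y≡z : ∀ x {y z} → x ⊕ y ≡ x ⊕ z → y ≡ z
  x⊕y≡x⊕z⇒y≡z x = ∙-cancelˡ x _ _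

  x⊕y⊖[z⊕y]≡x⊖z : ∀ x y z → (x ⊕ y) ⊖ (z ⊕ y) ≡ x ⊖ z
  x⊕y⊖[z⊕y]≡x⊖z x y z = begin
    (x ⊕ y) ⊕ ⊝ (z ⊕ y)      ≡⟨ cong ((x ⊕ y) ⊕_) (⁻¹-∙-comm z y) ⟨
    (x ⊕ y) ⊕ (⊝ z ⊕ ⊝ y)    ≡⟨ assoc x y (⊝ z ⊕ ⊝ y) ⟩
    x ⊕ (y ⊕ (⊝ z ⊕ ⊝ y))    ≡⟨ cong (x ⊕_) (comm y (⊝ z ⊕ ⊝ y)) ⟩
    x ⊕ ((⊝ z ⊕ ⊝ y) ⊕ y)    ≡⟨ cong (x ⊕_) (x⊖y⊕y≡x (⊝ z) y) ⟩
    x ⊖ z                    ∎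
    where open ≡-Reasoning

module CycleSums (𝔾 : FinAbGroup) {n : ℕ} (π : Permutation′ n) where
  open FinAbGroup 𝔾 renaming (_+_ to _⊕_; -_ to ⊝_)
  open IsAbelianGroup isAbelianGroup using (assoc; comm)
  open GroupLemmas 𝔾
  open Orbits 𝔾 π

  cycleSum : (Fin n → Carrier) → Fin n → Carrier
  cycleSum f i = sumBelow (cycLen i) (λ k → f (iter k i))

  cycleSum-rotate : ∀ f i → sumBelow (cycLen i) (λ k → f (iter (suc k) i)) ≡ cycleSum f i
  cycleSum-rotate f i = sumBelow-rotate (cycLen i) (λ k → f (iter k i)) (cong f (iter-cycLen i))

  cycleSum-π : ∀ f i → cycleSum f (π ⟨$⟩ʳ i) ≡ cycleSum f i
  cycleSum-π f i = begin
    sumBelow (cycLen (π ⟨$⟩ʳ i)) (λ k → f (iter k (π ⟨$⟩ʳ i)))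
      ≡⟨ cong (λ L → sumBelow L (λ k → f (iter k (π ⟨$⟩ʳ i)))) (cycLen-iter 1 i) ⟩
    sumBelow (cycLen i) (λ k → f (iter k (π ⟨$⟩ʳ i)))
      ≡⟨ sumBelow-cong (cycLen i) (λ k _ → cong f (iter-suc k i)) ⟨
    sumBelow (cycLen i) (λ k → f (iter (suc k) i))
      ≡⟨ cycleSum-rotate f i ⟩
    cycleSum f i ∎
    where open ≡-Reasoning

  cycleSum-iter : ∀ f d i → cycleSum f (iter d i) ≡ cycleSum f i
  cycleSum-iter f zero    i = refl
  cycleSum-iter f (suc d) i = trans (cycleSum-π f (iter d i)) (cycleSum-iter f d i)

  cycleSum-coboundary : (g h e : Fin n → Carrier) →
                        (∀ i → g (π ⟨$⟩ʳ i) ⊕ e i ≡ e (π ⟨$⟩ʳ i) ⊕ h (π ⟨$⟩ʳ i)) →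
                        ∀ i → cycleSum g i ≡ cycleSum h i
  cycleSum-coboundary g h e twisted i = x⊕y≡x⊕z⇒y≡z (cycleSum e i) (begin
    cycleSum e i ⊕ cycleSum g i                            ≡⟨ comm _ _ ⟩
    cycleSum g i ⊕ cycleSum e i                            ≡⟨ cong (_⊕ cycleSum e i) (cycleSum-rotate g i) ⟨
    along (λ k → g (iter (suc k) i)) ⊕ along (λ k → e (iter k i))
                                                           ≡⟨ sumBelow-∙ L _ _ ⟨
    along (λ k → g (iter (suc k) i) ⊕ e (iter k i))        ≡⟨ sumBelow-cong L (λ k _ → twisted (iter k i)) ⟩
    along (λ k → e (iter (suc k) i) ⊕ h (iter (suc k) i))  ≡⟨ sumBelow-∙ L _ _ ⟩
    along (λ k → e (iter (suc k) i)) ⊕ along (λ k → h (iter (suc k) i))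
                                                           ≡⟨ cong₂ _⊕_ (cycleSum-rotate e i) (cycleSum-rotate h i) ⟩
    cycleSum e i ⊕ cycleSum h i                            ∎)
    where
    open ≡-Reasoning
    L : ℕ
    L = cycLen i
    along : (ℕ → Carrier) → Carrier
    along = sumBelow L

  -- the partial sums of g ⊖ h along each cycle, started at its base point
  coboundary-from-cycleSum : (g h : Fin n → Carrier) → (∀ i → cycleSum g i ≡ cycleSum h i) →
                             ∃ λ e → ∀ i → g (π ⟨$⟩ʳ i) ⊕ e i ≡ e (π ⟨$⟩ʳ i) ⊕ h (π ⟨$⟩ʳ i)
  coboundary-from-cycleSum g h sums≡ = e , twisted
    where
    δ : Fin n → Carrier
    δ x = g x ⊖ h x

    pathSum : Fin n → ℕ → Carrier
    pathSum b d = sumBelow d (λ k → δ (iter (suc k) b))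

    e : Fin n → Carrier
    e i = pathSum (base i) (depth i)

    e-step : ∀ i → e (π ⟨$⟩ʳ i) ≡ pathSum (base i) (suc (depth i))
    e-step i with depth-step i
    ... | inj₁ (_ , depth≡) = cong₂ pathSum (base-iter 1 i) depth≡
    ... | inj₂ (sd≡L , depth≡0) = begin
      pathSum (base (π ⟨$⟩ʳ i)) (depth (π ⟨$⟩ʳ i))  ≡⟨ cong (pathSum (base (π ⟨$⟩ʳ i))) depth≡0 ⟩
      0#                                          ≡⟨ x⊖x≡0 (cycleSum g b) ⟨
      cycleSum g b ⊖ cycleSum g b                 ≡⟨ cong (cycleSum g b ⊖_) (sums≡ b) ⟩
      cycleSum g b ⊖ cycleSum h b                 ≡⟨ sumBelow-⊖ (cycLen b) _ _ ⟨
      cycleSum δ b                                ≡⟨ cycleSum-rotate δ b ⟨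
      pathSum b (cycLen b)                        ≡⟨ cong (pathSum b) (trans (cycLen-base i) (sym sd≡L)) ⟩
      pathSum b (suc (depth i))                   ∎
      where
      open ≡-Reasoning
      b : Fin n
      b = base i

    twisted : ∀ i → g (π ⟨$⟩ʳ i) ⊕ e i ≡ e (π ⟨$⟩ʳ i) ⊕ h (π ⟨$⟩ʳ i)
    twisted i = sym (begin
      e (π ⟨$⟩ʳ i) ⊕ h (π ⟨$⟩ʳ i)                        ≡⟨ cong (_⊕ h (π ⟨$⟩ʳ i)) (e-step i) ⟩
      (δ (iter (suc (depth i)) (base i)) ⊕ e i) ⊕ h (π ⟨$⟩ʳ i)
                                                        ≡⟨ cong (λ x → (δ x ⊕ e i) ⊕ h (π ⟨$⟩ʳ i)) (cong (π ⟨$⟩ʳ_) (iter-depth i)) ⟩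
      (δ (π ⟨$⟩ʳ i) ⊕ e i) ⊕ h (π ⟨$⟩ʳ i)                ≡⟨ assoc _ _ _ ⟩
      δ (π ⟨$⟩ʳ i) ⊕ (e i ⊕ h (π ⟨$⟩ʳ i))                ≡⟨ cong (δ (π ⟨$⟩ʳ i) ⊕_) (comm _ _) ⟩
      δ (π ⟨$⟩ʳ i) ⊕ (h (π ⟨$⟩ʳ i) ⊕ e i)                ≡⟨ assoc _ _ _ ⟨
      (δ (π ⟨$⟩ʳ i) ⊕ h (π ⟨$⟩ʳ i)) ⊕ e i                ≡⟨ cong (_⊕ e i) (x⊖y⊕y≡x _ _) ⟩
      g (π ⟨$⟩ʳ i) ⊕ e i                                ∎)
      where open ≡-Reasoning

module Intertwining (𝔾 : FinAbGroup) {n : ℕ} (π π′ ρ : Permutation′ n)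
                    (intertwines : ∀ i → ρ ⟨$⟩ʳ (π ⟨$⟩ʳ i) ≡ π′ ⟨$⟩ʳ (ρ ⟨$⟩ʳ i)) where
  private
    module O  = Orbits 𝔾 π
    module O′ = Orbits 𝔾 π′

  iter-intertwined : ∀ k i → ρ ⟨$⟩ʳ O.iter k i ≡ O′.iter k (ρ ⟨$⟩ʳ i)
  iter-intertwined zero    i = refl
  iter-intertwined (suc k) i = trans (intertwines (O.iter k i)) (cong (π′ ⟨$⟩ʳ_) (iter-intertwined k i))

  ρ-injective : ∀ {i j} → ρ ⟨$⟩ʳ i ≡ ρ ⟨$⟩ʳ j → i ≡ j
  ρ-injective e = trans (sym (inverseˡ ρ)) (trans (cong (ρ ⟨$⟩ˡ_) e) (inverseˡ ρ))

  cycLen-intertwined : ∀ i → O′.cycLen (ρ ⟨$⟩ʳ i) ≡ O.cycLen i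
  cycLen-intertwined i = O′.cycLen-unique (ρ ⟨$⟩ʳ i) (O.cycLen i)
    ( O.cycLen-pos i
    , trans (sym (iter-intertwined (O.cycLen i) i)) (cong (ρ ⟨$⟩ʳ_) (O.iter-cycLen i))
    , λ j 1≤j j<L returns → O.cycLen-minimal i j 1≤j j<L (ρ-injective (trans (iter-intertwined j i) returns)))

  cycleSum-intertwined : ∀ f i → CycleSums.cycleSum 𝔾 π′ f (ρ ⟨$⟩ʳ i) ≡ CycleSums.cycleSum 𝔾 π (f ∘ (ρ ⟨$⟩ʳ_)) i
  cycleSum-intertwined f i = trans (cong (λ L → sumBelow L (λ k → f (O′.iter k (ρ ⟨$⟩ʳ i)))) (cycLen-intertwined i))
                                   (sumBelow-cong (O.cycLen i) (λ k _ → cong f (sym (iter-intertwined k i))))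
    where open GroupLemmas 𝔾 using (sumBelow; sumBelow-cong)

module Conjugacy (𝔾 : FinAbGroup) (n : ℕ) where
  open FinAbGroup 𝔾 renaming (_+_ to _⊕_; -_ to ⊝_)
  open Wreath 𝔾 n using (W; ⟨_,_⟩; vec; perm; cycSign)
  open CycleSums 𝔾 using (cycleSum)

  -- the same device as in cycLen≡firstReturnFrom
  cycSign≡cycleSum : ∀ w i → cycSign w i ≡ cycleSum (perm w) (vec w) i
  cycSign≡cycleSum ⟨ g , π ⟩ i
    with GroupLemmas.sumBelow-unique 𝔾 (λ k → g (Wreath.iter 𝔾 n π k i)) _ refl (λ _ → refl)
       | Wreath.cycLen 𝔾 n π i
  ... | unique | L = unique L

  cycSign-iter : ∀ w d i → cycSign w (Wreath.iter 𝔾 n (perm w) d i) ≡ cycSign w i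
  cycSign-iter w d i = trans (cycSign≡cycleSum w _)
    (trans (CycleSums.cycleSum-iter 𝔾 (perm w) (vec w) d i) (sym (cycSign≡cycleSum w i)))

  -- z = x⁻¹ w x for x = (⊝ shift ∘ ρ⁻¹ , ρ), unfolded
  record Conjugate (z w : W) : Set where
    field
      ρ           : Permutation′ n
      shift       : Fin n → Carrier
      intertwines : ∀ i → ρ ⟨$⟩ʳ (perm z ⟨$⟩ʳ i) ≡ perm w ⟨$⟩ʳ (ρ ⟨$⟩ʳ i)
      twisted     : ∀ i → vec z (perm z ⟨$⟩ʳ i) ⊕ shift i ≡ shift (perm z ⟨$⟩ʳ i) ⊕ vec w (ρ ⟨$⟩ʳ (perm z ⟨$⟩ʳ i))

    open Intertwining 𝔾 (perm z) (perm w) ρ intertwines public using (cycLen-intertwined)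

    cycSign-conjugate : ∀ i → cycSign w (ρ ⟨$⟩ʳ i) ≡ cycSign z i
    cycSign-conjugate i = begin
      cycSign w (ρ ⟨$⟩ʳ i)                         ≡⟨ cycSign≡cycleSum w (ρ ⟨$⟩ʳ i) ⟩
      cycleSum (perm w) (vec w) (ρ ⟨$⟩ʳ i)         ≡⟨ Intertwining.cycleSum-intertwined 𝔾 (perm z) (perm w) ρ intertwines (vec w) i ⟩
      cycleSum (perm z) (vec w ∘ (ρ ⟨$⟩ʳ_)) i      ≡⟨ CycleSums.cycleSum-coboundary 𝔾 (perm z) (vec z) (vec w ∘ (ρ ⟨$⟩ʳ_)) shift twisted i ⟨
      cycleSum (perm z) (vec z) i                  ≡⟨ cycSign≡cycleSum z i ⟨
      cycSign z i                                  ∎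
      where open ≡-Reasoning

  conjugate-from-cycSign : ∀ z w (ρ : Permutation′ n) →
                           (∀ i → ρ ⟨$⟩ʳ (perm z ⟨$⟩ʳ i) ≡ perm w ⟨$⟩ʳ (ρ ⟨$⟩ʳ i)) →
                           (∀ i → cycSign w (ρ ⟨$⟩ʳ i) ≡ cycSign z i) → Conjugate z w
  conjugate-from-cycSign z w ρ intertwines signs≡ = record
    { ρ = ρ ; shift = proj₁ coboundary ; intertwines = intertwines ; twisted = proj₂ coboundary }
    where
    coboundary : ∃ λ e → ∀ i → vec z (perm z ⟨$⟩ʳ i) ⊕ e i ≡ e (perm z ⟨$⟩ʳ i) ⊕ vec w (ρ ⟨$⟩ʳ (perm z ⟨$⟩ʳ i))
    coboundary = CycleSums.coboundary-from-cycleSum 𝔾 (perm z) (vec z) (vec w ∘ (ρ ⟨$⟩ʳ_)) λ i → begin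
      cycleSum (perm z) (vec z) i               ≡⟨ cycSign≡cycleSum z i ⟨
      cycSign z i                               ≡⟨ signs≡ i ⟨
      cycSign w (ρ ⟨$⟩ʳ i)                      ≡⟨ cycSign≡cycleSum w (ρ ⟨$⟩ʳ i) ⟩
      cycleSum (perm w) (vec w) (ρ ⟨$⟩ʳ i)      ≡⟨ Intertwining.cycleSum-intertwined 𝔾 (perm z) (perm w) ρ intertwines (vec w) i ⟩
      cycleSum (perm z) (vec w ∘ (ρ ⟨$⟩ʳ_)) i   ∎
      where open ≡-Reasoning

-- Cycle types

replicate-++-injective : ∀ a b {x} {P Q : List ℕ} → All (_< x) P → All (_< x) Q →
                         replicate a x ++ P ≡ replicate b x ++ Q → a ≡ b × P ≡ Q
replicate-++-injective zero    zero    _        _        P≡Q = refl , P≡Q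
replicate-++-injective (suc a) (suc b) P<x      Q<x      eq  =
  let a≡b , P≡Q = replicate-++-injective a b P<x Q<x (ListP.∷-injectiveʳ eq) in cong suc a≡b , P≡Q
replicate-++-injective zero    (suc b) (p<x ∷ _) _        refl = ⊥-elim (ℕP.<-irrefl refl p<x)
replicate-++-injective (suc a) zero    _        (q<x ∷ _) refl = ⊥-elim (ℕP.<-irrefl refl q<x)

replicate-++-linked : ∀ m x {P : List ℕ} → All (_≤ x) P → Linked _≥_ P → Linked _≥_ (replicate m x ++ P)
replicate-++-linked zero    x P≤x       linked = linked
replicate-++-linked (suc m) x {P} P≤x linked with replicate m x ++ P | replicate-++-linked m x P≤x linked
                                                | AllP.++⁺ (AllP.replicate⁺ m (ℕP.≤-refl {x})) P≤x
... | []    | _        | _          = [-]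
... | _ ∷ _ | linked′  | y≤x ∷ _     = y≤x ∷ linked′

sum-replicate : ∀ m x → sum (replicate m x) ≡ m * x
sum-replicate zero    x = refl
sum-replicate (suc m) x = cong (x +_) (sum-replicate m x)

module _ (𝔾 : FinAbGroup) where
  open FinAbGroup 𝔾 using (Carrier)

  partsUpTo : ∀ N → Wreath.W 𝔾 N → Carrier → ℕ → Par
  partsUpTo N w h zero    = []
  partsUpTo N w h (suc k) = replicate (Wreath.mult 𝔾 N w k h) (suc k) ++ partsUpTo N w h k

  private
    partsUpTo-unique : (F : ∀ N → Wreath.W 𝔾 N → Carrier → ℕ → Par) → (∀ N w h → F N w h 0 ≡ []) →
                       (∀ N w h k → F N w h (suc k) ≡ replicate (Wreath.mult 𝔾 N w k h) (suc k) ++ F N w h k) →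
                       ∀ N w h k → F N w h k ≡ partsUpTo N w h k
    partsUpTo-unique F F0 Fsuc N w h zero    = F0 N w h
    partsUpTo-unique F F0 Fsuc N w h (suc k) = trans (Fsuc N w h k) (cong (_ ++_) (partsUpTo-unique F F0 Fsuc N w h k))

  -- the same device as in cycLen≡firstReturnFrom
  cycleType≡partsUpTo : ∀ N w h → Wreath.cycleType 𝔾 N w h ≡ partsUpTo N w h N
  cycleType≡partsUpTo zero    w h = refl
  cycleType≡partsUpTo (suc m) w h
    with partsUpTo-unique _ (λ _ _ _ → refl) (λ _ _ _ _ → refl) | m | suc m | w | h | Wreath.mult 𝔾 (suc m) w m h
  ... | unique | k | N | w′ | h′ | M = cong (replicate M N ++_) (unique N w′ h′ k)

module CycleTypes (𝔾 : FinAbGroup) (n : ℕ) where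
  open FinAbGroup 𝔾 renaming (_+_ to _⊕_; -_ to ⊝_)
  open Wreath 𝔾 n hiding (iter; cycLen)
  open Conjugacy 𝔾 n

  module _ (w : W) where
    open Orbits 𝔾 (perm w)

    -- Defs' mult w k h unfolds to countFin (onCycles (suc k) h) / suc k
    onCycles : ℕ → G → Fin n → Bool
    onCycles L h i = (cycLen i ≡ᵇ L) ∧ ⌊ cycSign w i ≟ h ⌋

    isCycleBase : ℕ → G → Fin n → Bool
    isCycleBase L h i = onCycles L h i ∧ (depth i ≡ᵇ 0)

    onCycles-π : ∀ L h i → onCycles L h (perm w ⟨$⟩ʳ i) ≡ onCycles L h i
    onCycles-π L h i = cong₂ (λ l s → (l ≡ᵇ L) ∧ ⌊ s ≟ h ⌋) (cycLen-iter 1 i) (cycSign-iter w 1 i)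

    -- π maps the points at depth d on the cycles of length L onto those at depth d + 1
    countFin-onCycles-depth : ∀ L h d → d < L →
      countFin (λ i → onCycles L h i ∧ (depth i ≡ᵇ d)) ≡ countFin (isCycleBase L h)
    countFin-onCycles-depth L h zero    _      = refl
    countFin-onCycles-depth L h (suc d) sd<L = begin
      countFin (λ i → onCycles L h i ∧ (depth i ≡ᵇ suc d))
        ≡⟨ countFin-permute (λ i → onCycles L h i ∧ (depth i ≡ᵇ suc d)) (perm w) ⟨
      countFin (λ i → onCycles L h (perm w ⟨$⟩ʳ i) ∧ (depth (perm w ⟨$⟩ʳ i) ≡ᵇ suc d))
        ≡⟨ countFin-cong step ⟩
      countFin (λ i → onCycles L h i ∧ (depth i ≡ᵇ d))
        ≡⟨ countFin-onCycles-depth L h d (ℕP.<-trans (ℕP.n<1+n d) sd<L) ⟩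
      countFin (isCycleBase L h) ∎
      where
      open ≡-Reasoning
      step : ∀ i → (onCycles L h (perm w ⟨$⟩ʳ i) ∧ (depth (perm w ⟨$⟩ʳ i) ≡ᵇ suc d)) ≡ (onCycles L h i ∧ (depth i ≡ᵇ d))
      step i rewrite onCycles-π L h i with onCycles L h i in onCycle | depth-step i
      ... | false | _                    = refl
      ... | true  | inj₁ (_ , depth≡)    = cong (_≡ᵇ suc d) depth≡
      ... | true  | inj₂ (sd≡L , depth≡0) rewrite depth≡0 = sym (dec-false (depth i ℕP.≟ d) λ depth≡d →
        ℕP.<-irrefl (trans (cong suc (sym depth≡d)) (trans sd≡L (≡ᵇ≡true⇒≡ (BoolP.∧-conicalˡ _ _ onCycle)))) sd<L)

    countFin-onCycles : ∀ L h → countFin (onCycles L h) ≡ L * countFin (isCycleBase L h)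
    countFin-onCycles L h = begin
      countFin (onCycles L h)                                          ≡⟨ countFin-fibres L (onCycles L h) depth depth<L ⟩
      sumBelowℕ L (λ d → countFin (λ i → onCycles L h i ∧ (depth i ≡ᵇ d))) ≡⟨ sumBelowℕ-const L _ _ (countFin-onCycles-depth L h) ⟩
      L * countFin (isCycleBase L h)                                   ∎
      where
      open ≡-Reasoning
      depth<L : ∀ i → onCycles L h i ≡ true → depth i < L
      depth<L i onCycle = subst (depth i <_) (≡ᵇ≡true⇒≡ (BoolP.∧-conicalˡ _ _ onCycle)) (depth-< i)

    mult≡countFin-isCycleBase : ∀ k h → mult w k h ≡ countFin (isCycleBase (suc k) h)
    mult≡countFin-isCycleBase k h = begin
      countFin (onCycles (suc k) h) / suc k                     ≡⟨ cong (_/ suc k) (countFin-onCycles (suc k) h) ⟩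
      suc k * countFin (isCycleBase (suc k) h) / suc k          ≡⟨ cong (_/ suc k) (ℕP.*-comm (suc k) (countFin (isCycleBase (suc k) h))) ⟩
      countFin (isCycleBase (suc k) h) * suc k / suc k          ≡⟨ m*n/n≡m (countFin (isCycleBase (suc k) h)) (suc k) ⟩
      countFin (isCycleBase (suc k) h)                          ∎
      where open ≡-Reasoning

    countFin-cycSign : ∀ h → countFin (λ i → ⌊ cycSign w i ≟ h ⌋) ≡ sumBelowℕ n (λ k → countFin (onCycles (suc k) h))
    countFin-cycSign h = trans (countFin-fibres n _ (λ i → cycLen i ∸ 1) (λ i _ → cycLen-1<n i))
                               (sumBelowℕ-cong n (λ k _ → countFin-cong (reorder k)))
      where
      cycLen-1<n : ∀ i → cycLen i ∸ 1 < n
      cycLen-1<n i = ℕP.<-≤-trans (ℕP.∸-monoˡ-< (ℕP.n<1+n (cycLen i)) (cycLen-pos i)) (cycLen-≤ i)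
      reorder : ∀ k i → (⌊ cycSign w i ≟ h ⌋ ∧ ((cycLen i ∸ 1) ≡ᵇ k)) ≡ onCycles (suc k) h i
      reorder k i = swap ⌊ cycSign w i ≟ h ⌋ (cycLen-pos i)
        where
        swap : ∀ b {L} → 1 ≤ L → (b ∧ ((L ∸ 1) ≡ᵇ k)) ≡ ((L ≡ᵇ suc k) ∧ b)
        swap b {suc l} _ = BoolP.∧-comm b (l ≡ᵇ k)

  parts : W → G → ℕ → Par
  parts = partsUpTo 𝔾 n

  module _ (w : W) (h : G) where
    partsUpTo-< : ∀ N → All (_< suc N) (parts w h N)
    partsUpTo-< zero    = []
    partsUpTo-< (suc N) = AllP.++⁺ (AllP.replicate⁺ (mult w N h) ℕP.≤-refl) (All.map ℕP.m<n⇒m<1+n (partsUpTo-< N))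

    partsUpTo-pos : ∀ N → All (0 <_) (parts w h N)
    partsUpTo-pos zero    = []
    partsUpTo-pos (suc N) = AllP.++⁺ (AllP.replicate⁺ (mult w N h) (s≤s z≤n)) (partsUpTo-pos N)

    partsUpTo-linked : ∀ N → Linked _≥_ (parts w h N)
    partsUpTo-linked zero    = []
    partsUpTo-linked (suc N) = replicate-++-linked (mult w N h) (suc N) (All.map ℕP.<⇒≤ (partsUpTo-< N)) (partsUpTo-linked N)

    size-partsUpTo : ∀ N → size (parts w h N) ≡ sumBelowℕ N (λ k → countFin (onCycles w (suc k) h))
    size-partsUpTo zero    = refl
    size-partsUpTo (suc N) = begin
      sum (replicate m (suc N) ++ parts w h N)         ≡⟨ ListSumP.sum-++ (replicate m (suc N)) (parts w h N) ⟩
      sum (replicate m (suc N)) + size (parts w h N)   ≡⟨ cong₂ _+_ (sum-replicate m (suc N)) (size-partsUpTo N) ⟩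
      m * suc N + rest                                 ≡⟨ cong (_+ rest) (ℕP.*-comm m (suc N)) ⟩
      suc N * m + rest                                 ≡⟨ cong (λ m → suc N * m + rest) (mult≡countFin-isCycleBase w N h) ⟩
      suc N * countFin (isCycleBase w (suc N) h) + rest ≡⟨ cong (_+ rest) (countFin-onCycles w (suc N) h) ⟨
      countFin (onCycles w (suc N) h) + rest           ∎
      where
      open ≡-Reasoning
      m : ℕ
      m = mult w N h
      rest : ℕ
      rest = sumBelowℕ N (λ k → countFin (onCycles w (suc k) h))

  cycleType-isPartition : ∀ w h → IsPartition (cycleType w h)
  cycleType-isPartition w h rewrite cycleType≡partsUpTo 𝔾 n w h = partsUpTo-pos w h n , partsUpTo-linked w h n

  size-cycleType : ∀ w h → size (cycleType w h) ≡ countFin (λ i → ⌊ cycSign w i ≟ h ⌋)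
  size-cycleType w h = begin
    size (cycleType w h)                                      ≡⟨ cong size (cycleType≡partsUpTo 𝔾 n w h) ⟩
    size (parts w h n)                                        ≡⟨ size-partsUpTo w h n ⟩
    sumBelowℕ n (λ k → countFin (onCycles w (suc k) h))       ≡⟨ countFin-cycSign w h ⟨
    countFin (λ i → ⌊ cycSign w i ≟ h ⌋)                      ∎
    where open ≡-Reasoning

  -- every point lies on a cycle of exactly one sign
  size-cycleType-total : ∀ w → sumFin (λ j → size (cycleType w (elt j))) ≡ n
  size-cycleType-total w = begin
    sumFin (λ j → size (cycleType w (elt j)))
      ≡⟨ sumFin-cong (λ j → trans (size-cycleType w (elt j)) (countFin≡sumFin (λ i → ⌊ cycSign w i ≟ elt j ⌋))) ⟩
    sumFin (λ j → sumFin (λ i → indicator ⌊ cycSign w i ≟ elt j ⌋))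
      ≡⟨ sumFin-swap (λ j i → indicator ⌊ cycSign w i ≟ elt j ⌋) ⟩
    sumFin (λ i → sumFin (λ j → indicator ⌊ cycSign w i ≟ elt j ⌋))
      ≡⟨ sumFin-cong (λ i → sumFin-single _ (index (cycSign w i)) (atSign i) (offSign i)) ⟩
    sumFin {n} (λ _ → 1)
      ≡⟨ sumFin-const {n} 1 ⟩
    n * 1
      ≡⟨ ℕP.*-identityʳ n ⟩
    n ∎
    where
    open ≡-Reasoning
    atSign : ∀ i → indicator ⌊ cycSign w i ≟ elt (index (cycSign w i)) ⌋ ≡ 1
    atSign i = cong indicator (⌊⌋≡true (cycSign w i ≟ _) (sym (Inverse.strictlyInverseˡ enum (cycSign w i))))
    offSign : ∀ i j → j ≢ index (cycSign w i) → indicator ⌊ cycSign w i ≟ elt j ⌋ ≡ 0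
    offSign i j j≢ = cong indicator (⌊⌋≡false (cycSign w i ≟ elt j) λ sign≡ →
      j≢ (trans (sym (Inverse.strictlyInverseʳ enum j)) (cong index (sym sign≡))))

  cycleType-InΛ : ∀ w → InΛ (cycleType w)
  cycleType-InΛ w = cycleType-isPartition w , size-cycleType-total w

  cycleType≡⇒mult≡ : ∀ z w h → cycleType z h ≡ cycleType w h → ∀ k → k < n → mult z k h ≡ mult w k h
  cycleType≡⇒mult≡ z w h types≡ = go n (begin
    parts z h n       ≡⟨ cycleType≡partsUpTo 𝔾 n z h ⟨
    cycleType z h     ≡⟨ types≡ ⟩
    cycleType w h     ≡⟨ cycleType≡partsUpTo 𝔾 n w h ⟩
    parts w h n       ∎)
    where
    open ≡-Reasoning
    go : ∀ N → parts z h N ≡ parts w h N → ∀ k → k < N → mult z k h ≡ mult w k h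
    go (suc N) parts≡ k k<N with replicate-++-injective (mult z N h) (mult w N h) (partsUpTo-< z h N) (partsUpTo-< w h N) parts≡
    ... | mults≡ , rest≡ with ℕP.m≤n⇒m<n∨m≡n (ℕP.≤-pred k<N)
    ...   | inj₁ k<N′  = go N rest≡ k k<N′
    ...   | inj₂ refl  = mults≡

  mult≡⇒cycleType≡ : ∀ z w h → (∀ k → k < n → mult z k h ≡ mult w k h) → cycleType z h ≡ cycleType w h
  mult≡⇒cycleType≡ z w h mults≡ = begin
    cycleType z h  ≡⟨ cycleType≡partsUpTo 𝔾 n z h ⟩
    parts z h n    ≡⟨ go n ℕP.≤-refl ⟩
    parts w h n    ≡⟨ cycleType≡partsUpTo 𝔾 n w h ⟨
    cycleType w h  ∎
    where
    open ≡-Reasoning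
    go : ∀ N → N ≤ n → parts z h N ≡ parts w h N
    go zero    _   = refl
    go (suc N) N<n = cong₂ (λ m rest → replicate m (suc N) ++ rest) (mults≡ N N<n) (go N (ℕP.<⇒≤ N<n))

  conjugate⇒cycleType≡ : ∀ {z w} → Conjugate z w → ∀ h → cycleType w h ≡ cycleType z h
  conjugate⇒cycleType≡ {z} {w} z~w h = mult≡⇒cycleType≡ w z h λ k _ → cong (_/ suc k) (begin
    countFin (onCycles w (suc k) h)                       ≡⟨ countFin-permute (onCycles w (suc k) h) ρ ⟨
    countFin (λ i → onCycles w (suc k) h (ρ ⟨$⟩ʳ i))      ≡⟨ countFin-cong (λ i → cong₂ (λ l s → (l ≡ᵇ suc k) ∧ ⌊ s ≟ h ⌋)
                                                               (cycLen-intertwined i) (cycSign-conjugate i)) ⟩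
    countFin (onCycles z (suc k) h)                       ∎)
    where
    open ≡-Reasoning
    open Conjugate z~w

  IsIdentity : W → Set
  IsIdentity w = (∀ i → perm w ⟨$⟩ʳ i ≡ i) × (∀ i → vec w i ≡ 0#)

  identity : W
  identity = ⟨ (λ _ → 0#) , Perm.id ⟩

  module _ {w : W} where
    open Orbits 𝔾 (perm w)

    cycLen≡1 : ∀ i → perm w ⟨$⟩ʳ i ≡ i → cycLen i ≡ 1
    cycLen≡1 i fixed = cycLen-unique i 1 (ℕP.≤-refl , fixed , λ j 1≤j j<1 _ → ℕP.<-irrefl refl (ℕP.≤-trans j<1 1≤j))

    cycSign-fixed : ∀ i → perm w ⟨$⟩ʳ i ≡ i → cycSign w i ≡ vec w i
    cycSign-fixed i fixed = begin
      cycSign w i                                          ≡⟨ cycSign≡cycleSum w i ⟩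
      sumBelow (cycLen i) (λ k → vec w (iter k i))         ≡⟨ cong (λ L → sumBelow L (λ k → vec w (iter k i))) (cycLen≡1 i fixed) ⟩
      vec w i ⊕ 0#                                         ≡⟨ IsAbelianGroup.identityʳ isAbelianGroup (vec w i) ⟩
      vec w i                                              ∎
      where
      open ≡-Reasoning
      open GroupLemmas 𝔾 using (sumBelow)

    module _ (isIdentity : IsIdentity w) where
      private
        fixed : ∀ i → perm w ⟨$⟩ʳ i ≡ i
        fixed = proj₁ isIdentity
        zero-vec : ∀ i → vec w i ≡ 0#
        zero-vec = proj₂ isIdentity

        onFixedPoints : ∀ L h i → onCycles w L h i ≡ ((1 ≡ᵇ L) ∧ ⌊ 0# ≟ h ⌋)
        onFixedPoints L h i = cong₂ (λ l s → (l ≡ᵇ L) ∧ ⌊ s ≟ h ⌋) (cycLen≡1 i (fixed i))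
                                    (trans (cycSign-fixed i (fixed i)) (zero-vec i))

      mult-identity-0 : mult w 0 0# ≡ n
      mult-identity-0 = trans (n/1≡n _) (trans
        (countFin-cong (λ i → trans (onFixedPoints 1 0# i) (cong (true ∧_) (⌊⌋≡true (0# ≟ 0#) refl))))
        (countFin-all {n} (λ _ → true) (λ _ → refl)))

      mult-identity-suc : ∀ k → mult w (suc k) 0# ≡ 0
      mult-identity-suc k = trans
        (cong (_/ suc (suc k)) (trans (countFin-cong (onFixedPoints (suc (suc k)) 0#)) (countFin-none {n} (λ _ → false) (λ _ → refl))))
        (0/n≡0 (suc (suc k)))

      cycleType-identity : 1 ≤ n → cycleType w 0# ≡ 1ⁿ
      cycleType-identity 1≤n = trans (cycleType≡partsUpTo 𝔾 n w 0#) (go n 1≤n)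
        where
        go : ∀ N → 1 ≤ N → parts w 0# N ≡ replicate n 1
        go 1             _ = trans (cong (λ m → replicate m 1 ++ []) mult-identity-0) (ListP.++-identityʳ (replicate n 1))
        go (suc (suc N)) _ = trans (cong (λ m → replicate m (suc (suc N)) ++ parts w 0# (suc N)) (mult-identity-suc N))
                                   (go (suc N) (s≤s z≤n))

  identity-isIdentity : IsIdentity identity
  identity-isIdentity = (λ _ → refl) , (λ _ → refl)

  ≈W⇒isIdentity : ∀ x y → x ≈W y → IsIdentity ((x ⁻¹) · y)
  ≈W⇒isIdentity ⟨ g , π ⟩ ⟨ g′ , σ ⟩ (vec≡ , perm≡) =
    (λ i → trans (cong (π ⟨$⟩ˡ_) (sym (perm≡ i))) (inverseˡ π)) ,
    (λ i → trans (cong (⊝ g (π ⟨$⟩ʳ i) ⊕_) (sym (vec≡ (π ⟨$⟩ʳ i)))) (IsAbelianGroup.inverseˡ isAbelianGroup (g (π ⟨$⟩ʳ i))))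

  isIdentity⇒≈W : ∀ x y → IsIdentity ((x ⁻¹) · y) → x ≈W y
  isIdentity⇒≈W ⟨ g , π ⟩ ⟨ g′ , σ ⟩ (fixed , trivial) = vec≡ , perm≡
    where
    perm≡ : ∀ j → π ⟨$⟩ʳ j ≡ σ ⟨$⟩ʳ j
    perm≡ j = sym (trans (sym (inverseʳ π)) (cong (π ⟨$⟩ʳ_) (fixed j)))
    vec≡ : ∀ j → g j ≡ g′ j
    vec≡ j = subst (λ k → g k ≡ g′ k) (inverseʳ π) (GroupLemmas.⊝x⊕y≡0⇒x≡y 𝔾 _ _ (trivial (π ⟨$⟩ˡ j)))

  module _ {w : W} where
    open Orbits 𝔾 (perm w)

    cycleType≡1ⁿ⇒isIdentity : 1 ≤ n → cycleType w 0# ≡ 1ⁿ → IsIdentity w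
    cycleType≡1ⁿ⇒isIdentity 1≤n type≡1ⁿ = fixed , zero-vec
      where
      mult-0 : mult w 0 0# ≡ n
      mult-0 = trans (cycleType≡⇒mult≡ w identity 0#
                        (trans type≡1ⁿ (sym (cycleType-identity identity-isIdentity 1≤n))) 0 1≤n)
                     (mult-identity-0 identity-isIdentity)
      fixedWithSign0 : ∀ i → onCycles w 1 0# i ≡ true
      fixedWithSign0 = countFin≡k⇒all (onCycles w 1 0#) (trans (sym (n/1≡n _)) mult-0)
      fixed : ∀ i → perm w ⟨$⟩ʳ i ≡ i
      fixed i = trans (cong (λ L → iter L i) (sym (≡ᵇ≡true⇒≡ {cycLen i} {1} (BoolP.∧-conicalˡ _ _ (fixedWithSign0 i)))))
                      (iter-cycLen i)
      zero-vec : ∀ i → vec w i ≡ 0#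
      zero-vec i = trans (sym (cycSign-fixed i (fixed i))) (⌊⌋≡true⇒ (cycSign w i ≟ 0#) (BoolP.∧-conicalʳ _ _ (fixedWithSign0 i)))

-- Elements of equal cycle type are conjugate

nextDepth : ℕ → ℕ → ℕ
nextDepth L d = if suc d ≡ᵇ L then 0 else suc d

module CycleMatching (𝔾 : FinAbGroup) (n : ℕ) where
  open FinAbGroup 𝔾 renaming (_+_ to _⊕_; -_ to ⊝_)
  open Wreath 𝔾 n hiding (iter; cycLen)
  open Conjugacy 𝔾 n
  open CycleTypes 𝔾 n

  CycleKey : Set
  CycleKey = ℕ × G × ℕ × ℕ

  stepKey : CycleKey → CycleKey
  stepKey (L , s , d , r) = L , s , nextDepth L d , r

  module Keys (w : W) where
    open Orbits 𝔾 (perm w)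

    key : Fin n → CycleKey
    key i = cycLen i , cycSign w i , depth i , rank (isCycleBase w (cycLen i) (cycSign w i)) (base i)

    cycSign-base : ∀ i → cycSign w (base i) ≡ cycSign w i
    cycSign-base i = let d , iterᵈ≡base = sameCycle-base i in trans (cong (cycSign w) (sym iterᵈ≡base)) (cycSign-iter w d i)

    isCycleBase-base : ∀ i → isCycleBase w (cycLen i) (cycSign w i) (base i) ≡ true
    isCycleBase-base i =
      cong₂ _∧_ (cong₂ _∧_ (≡⇒≡ᵇ≡true (cycLen-base i)) (⌊⌋≡true (_ ≟ _) (cycSign-base i))) (≡⇒≡ᵇ≡true (depth-base i))

    isCycleBase⇒ : ∀ L s j → isCycleBase w L s j ≡ true → cycLen j ≡ L × cycSign w j ≡ s × depth j ≡ 0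
    isCycleBase⇒ L s j isBase =
      let onCycle = BoolP.∧-conicalˡ _ _ isBase
      in ≡ᵇ≡true⇒≡ (BoolP.∧-conicalˡ _ _ onCycle) , ⌊⌋≡true⇒ (cycSign w j ≟ s) (BoolP.∧-conicalʳ _ _ onCycle) ,
         ≡ᵇ≡true⇒≡ (BoolP.∧-conicalʳ _ _ isBase)

    key-injective : ∀ {i j} → key i ≡ key j → i ≡ j
    key-injective {i} {j} key≡ = begin
      i                            ≡⟨ iter-depth i ⟨
      iter (depth i) (base i)      ≡⟨ cong₂ iter (cong (proj₁ ∘ proj₂ ∘ proj₂) key≡) bases≡ ⟩
      iter (depth j) (base j)      ≡⟨ iter-depth j ⟩
      j                            ∎
      where
      open ≡-Reasoning
      bases : Fin n → Bool
      bases = isCycleBase w (cycLen i) (cycSign w i)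
      bases≡ : base i ≡ base j
      bases≡ = rank-injective bases (isCycleBase-base i)
        (subst₂ (λ L s → isCycleBase w L s (base j) ≡ true) (sym (cong proj₁ key≡)) (sym (cong (proj₁ ∘ proj₂) key≡)) (isCycleBase-base j))
        (trans (cong (proj₂ ∘ proj₂ ∘ proj₂) key≡)
               (cong₂ (λ L s → rank (isCycleBase w L s) (base j)) (sym (cong proj₁ key≡)) (sym (cong (proj₁ ∘ proj₂) key≡))))

    depth-π : ∀ i → depth (perm w ⟨$⟩ʳ i) ≡ nextDepth (cycLen i) (depth i)
    depth-π i with depth-step i
    ... | inj₁ (sd<L , depth≡)  rewrite dec-false (suc (depth i) ℕP.≟ cycLen i) (ℕP.<⇒≢ sd<L) = depth≡
    ... | inj₂ (sd≡L , depth≡0) rewrite ≡⇒≡ᵇ≡true sd≡L = depth≡0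

    key-π : ∀ i → key (perm w ⟨$⟩ʳ i) ≡ stepKey (key i)
    key-π i = cong₂ _,_ (cycLen-iter 1 i) (cong₂ _,_ (cycSign-iter w 1 i) (cong₂ _,_ (depth-π i)
      (cong₃ (λ L s b → rank (isCycleBase w L s) b) (cycLen-iter 1 i) (cycSign-iter w 1 i) (base-iter 1 i))))

  module _ (a b : W) (mults≡ : ∀ k h → k < n → mult a k h ≡ mult b k h) where
    private
      module A = Keys a
      module B = Keys b
      module OA = Orbits 𝔾 (perm a)
      module OB = Orbits 𝔾 (perm b)

    countFin-isCycleBase≡ : ∀ L s → 1 ≤ L → L ≤ n → countFin (isCycleBase a L s) ≡ countFin (isCycleBase b L s)
    countFin-isCycleBase≡ (suc k) s _ L≤n =
      trans (sym (mult≡countFin-isCycleBase a k s)) (trans (mults≡ k s L≤n) (mult≡countFin-isCycleBase b k s))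

    key-image : ∀ i → ∃ λ j → B.key j ≡ A.key i
    key-image i = j , cong₂ _,_ cycLen-j (cong₂ _,_ sign-j (cong₂ _,_ depth-j
      (trans (cong₃ (λ L s x → rank (isCycleBase b L s) x) cycLen-j sign-j base-j) rank-M)))
      where
      L : ℕ
      L = OA.cycLen i
      s : G
      s = cycSign a i
      d : ℕ
      d = OA.depth i
      r : ℕ
      r = rank (isCycleBase a L s) (OA.base i)
      r<count : r < countFin (isCycleBase b L s)
      r<count = subst (r <_) (countFin-isCycleBase≡ L s (OA.cycLen-pos i) (OA.cycLen-≤ i))
                             (rank-< (isCycleBase a L s) (A.isCycleBase-base i))
      found : ∃ λ M → isCycleBase b L s M ≡ true × rank (isCycleBase b L s) M ≡ r
      found = rank-surjective (isCycleBase b L s) r<count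
      M : Fin n
      M = proj₁ found
      rank-M : rank (isCycleBase b L s) M ≡ r
      rank-M = proj₂ (proj₂ found)
      M-isBase : OB.cycLen M ≡ L × cycSign b M ≡ s × OB.depth M ≡ 0
      M-isBase = B.isCycleBase⇒ L s M (proj₁ (proj₂ found))
      j : Fin n
      j = OB.iter d M
      cycLen-j : OB.cycLen j ≡ L
      cycLen-j = trans (OB.cycLen-iter d M) (proj₁ M-isBase)
      sign-j : cycSign b j ≡ s
      sign-j = trans (cycSign-iter b d M) (proj₁ (proj₂ M-isBase))
      depth-j : OB.depth j ≡ d
      depth-j = OB.depth-iter-base M d (proj₂ (proj₂ M-isBase)) (subst (d <_) (sym (proj₁ M-isBase)) (OA.depth-< i))
      base-j : OB.base j ≡ M
      base-j = trans (OB.base-iter d M) (OB.depth≡0⇒base≡ M (proj₂ (proj₂ M-isBase)))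

  sameCycleType⇒conjugate : ∀ z w → (∀ h → cycleType z h ≡ cycleType w h) → Conjugate z w
  sameCycleType⇒conjugate z w types≡ = conjugate-from-cycSign z w ρ intertwines signs≡
    where
    module Z = Keys z
    module W′ = Keys w
    mults≡ : ∀ k h → k < n → mult z k h ≡ mult w k h
    mults≡ k h = cycleType≡⇒mult≡ z w h (types≡ h) k
    matching : ∃ λ (ρ : Permutation′ n) → ∀ i → W′.key (ρ ⟨$⟩ʳ i) ≡ Z.key i
    matching = permutationMatchingKeys Z.key W′.key Z.key-injective W′.key-injective
                 (key-image z w mults≡) (key-image w z (λ k h k<n → sym (mults≡ k h k<n)))
    ρ : Permutation′ n
    ρ = proj₁ matching
    key-ρ : ∀ i → W′.key (ρ ⟨$⟩ʳ i) ≡ Z.key i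
    key-ρ = proj₂ matching
    intertwines : ∀ i → ρ ⟨$⟩ʳ (perm z ⟨$⟩ʳ i) ≡ perm w ⟨$⟩ʳ (ρ ⟨$⟩ʳ i)
    intertwines i = W′.key-injective (begin
      W′.key (ρ ⟨$⟩ʳ (perm z ⟨$⟩ʳ i))   ≡⟨ key-ρ (perm z ⟨$⟩ʳ i) ⟩
      Z.key (perm z ⟨$⟩ʳ i)             ≡⟨ Z.key-π i ⟩
      stepKey (Z.key i)                 ≡⟨ cong stepKey (key-ρ i) ⟨
      stepKey (W′.key (ρ ⟨$⟩ʳ i))       ≡⟨ W′.key-π (ρ ⟨$⟩ʳ i) ⟨
      W′.key (perm w ⟨$⟩ʳ (ρ ⟨$⟩ʳ i))   ∎)
      where open ≡-Reasoning
    signs≡ : ∀ i → cycSign w (ρ ⟨$⟩ʳ i) ≡ cycSign z i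
    signs≡ i = cong (proj₁ ∘ proj₂) (key-ρ i)

-- Tabloids and the inner distribution

module Tabloids (𝔾 : FinAbGroup) (n : ℕ) where
  open FinAbGroup 𝔾 renaming (_+_ to _⊕_; -_ to ⊝_)
  open IsAbelianGroup isAbelianGroup using (assoc; comm)
  open GroupLemmas 𝔾 using (_⊖_; x⊕y⊖[z⊕y]≡x⊖z; y⊕[x⊖y]≡x; x⊖y⊕y≡x)
  open Wreath 𝔾 n hiding (iter; cycLen)
  open Conjugacy 𝔾 n

  Tabloid : Set
  Tabloid = Fin n → Entry

  twist : Permutation′ n → (Fin n → G) → Tabloid → Tabloid
  twist ρ e t i = entry (sub (t (ρ ⟨$⟩ʳ i))) (row (t (ρ ⟨$⟩ʳ i))) (coset (t (ρ ⟨$⟩ʳ i)) ⊕ e i)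

  Fixes-cong : ∀ w {t t′} → (∀ i → t i ≡ t′ i) → Fixes w t → Fixes w t′
  Fixes-cong ⟨ g , π ⟩ {t} {t′} t≡t′ fixes i =
    subst₂ (λ x y → sub x ≡ sub y × row x ≡ row y × SameCoset (sub y) (coset y ⊕ g (π ⟨$⟩ʳ i)) (coset x))
           (t≡t′ (π ⟨$⟩ʳ i)) (t≡t′ i) (fixes i)

  Fixes-conjugate : ∀ {z w} (z~w : Conjugate z w) → ∀ t →
                    Fixes w t → Fixes z (twist (Conjugate.ρ z~w) (Conjugate.shift z~w) t)
  Fixes-conjugate {⟨ g , π ⟩} {⟨ g′ , π′ ⟩} z~w t fixes i =
    trans (cong (sub ∘ t) (intertwines i)) (proj₁ (fixes (ρ ⟨$⟩ʳ i))) ,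
    trans (cong (row ∘ t) (intertwines i)) (proj₁ (proj₂ (fixes (ρ ⟨$⟩ʳ i)))) ,
    subst (_∈G sub (t (ρ ⟨$⟩ʳ i))) (sym cosets≡) (subst (λ x → SameCoset (sub (t (ρ ⟨$⟩ʳ i))) (c (ρ ⟨$⟩ʳ i) ⊕ g′ x) (c x))
                                                       (sym (intertwines i)) (proj₂ (proj₂ (fixes (ρ ⟨$⟩ʳ i)))))
    where
    open Conjugate z~w
    open ≡-Reasoning
    c : Fin n → G
    c = coset ∘ t
    cosets≡ : ((c (ρ ⟨$⟩ʳ i) ⊕ shift i) ⊕ g (π ⟨$⟩ʳ i)) ⊖ (c (ρ ⟨$⟩ʳ (π ⟨$⟩ʳ i)) ⊕ shift (π ⟨$⟩ʳ i))
            ≡ (c (ρ ⟨$⟩ʳ i) ⊕ g′ (ρ ⟨$⟩ʳ (π ⟨$⟩ʳ i))) ⊖ c (ρ ⟨$⟩ʳ (π ⟨$⟩ʳ i))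
    cosets≡ = trans (cong (_⊖ (c (ρ ⟨$⟩ʳ (π ⟨$⟩ʳ i)) ⊕ shift (π ⟨$⟩ʳ i))) (begin
      (c (ρ ⟨$⟩ʳ i) ⊕ shift i) ⊕ g (π ⟨$⟩ʳ i)                         ≡⟨ assoc _ _ _ ⟩
      c (ρ ⟨$⟩ʳ i) ⊕ (shift i ⊕ g (π ⟨$⟩ʳ i))                         ≡⟨ cong (c (ρ ⟨$⟩ʳ i) ⊕_) (comm _ _) ⟩
      c (ρ ⟨$⟩ʳ i) ⊕ (g (π ⟨$⟩ʳ i) ⊕ shift i)                         ≡⟨ cong (c (ρ ⟨$⟩ʳ i) ⊕_) (twisted i) ⟩
      c (ρ ⟨$⟩ʳ i) ⊕ (shift (π ⟨$⟩ʳ i) ⊕ g′ (ρ ⟨$⟩ʳ (π ⟨$⟩ʳ i)))      ≡⟨ cong (c (ρ ⟨$⟩ʳ i) ⊕_) (comm _ _) ⟩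
      c (ρ ⟨$⟩ʳ i) ⊕ (g′ (ρ ⟨$⟩ʳ (π ⟨$⟩ʳ i)) ⊕ shift (π ⟨$⟩ʳ i))      ≡⟨ assoc _ _ _ ⟨
      (c (ρ ⟨$⟩ʳ i) ⊕ g′ (ρ ⟨$⟩ʳ (π ⟨$⟩ʳ i))) ⊕ shift (π ⟨$⟩ʳ i)      ∎))
      (x⊕y⊖[z⊕y]≡x⊖z _ _ _)

  inRow : Tabloid → Subset order → ℕ → Fin n → Bool
  inRow t U r i = does (VecP.≡-dec Data.Bool._≟_ (sub (t i)) U) ∧ (row (t i) ≡ᵇ r)

  twist-isTabloid : ∀ σ ρ e {t} → IsTabloid σ t → IsTabloid σ (twist ρ e t)
  twist-isTabloid σ ρ e {t} (rows< , rowSizes) =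
    (λ i → rows< (ρ ⟨$⟩ʳ i)) , (λ U r r<l → trans (countFin-permute (inRow t U r) ρ) (rowSizes U r r<l))

  module _ (σ : Subset order → Par) where
    private
      inRow-self : ∀ t i → inRow t (sub (t i)) (row (t i)) i ≡ true
      inRow-self t i = cong₂ _∧_ (dec-true (VecP.≡-dec Data.Bool._≟_ (sub (t i)) (sub (t i))) refl) (≡⇒≡ᵇ≡true {row (t i)} refl)

      inRow⇒ : ∀ t U r i → inRow t U r i ≡ true → sub (t i) ≡ U × row (t i) ≡ r
      inRow⇒ t U r i inRowᵢ = does≡true⇒ (VecP.≡-dec Data.Bool._≟_ (sub (t i)) U) (BoolP.∧-conicalˡ _ _ inRowᵢ) ,
                              ≡ᵇ≡true⇒≡ (BoolP.∧-conicalʳ _ _ inRowᵢ)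

    boxKey : Tabloid → Fin n → Subset order × ℕ × ℕ
    boxKey t i = sub (t i) , row (t i) , rank (inRow t (sub (t i)) (row (t i))) i

    boxKey-injective : ∀ t {a b} → boxKey t a ≡ boxKey t b → a ≡ b
    boxKey-injective t {a} {b} key≡ = rank-injective (inRow t (sub (t a)) (row (t a))) (inRow-self t a)
      (subst₂ (λ U r → inRow t U r b ≡ true) (sym sub≡) (sym row≡) (inRow-self t b))
      (trans (cong (proj₂ ∘ proj₂) key≡) (cong₂ (λ U r → rank (inRow t U r) b) (sym sub≡) (sym row≡)))
      where
      sub≡ : sub (t a) ≡ sub (t b)
      sub≡ = cong proj₁ key≡
      row≡ : row (t a) ≡ row (t b)
      row≡ = cong (proj₁ ∘ proj₂) key≡

    boxKey-image : ∀ t t′ → IsTabloid σ t → IsTabloid σ t′ → ∀ i → ∃ λ j → boxKey t′ j ≡ boxKey t i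
    boxKey-image t t′ (rows< , rowSizes) (_ , rowSizes′) i =
      j , trans (cong₂ (λ U r → U , r , rank (inRow t′ U r) j) sub≡ row≡) (cong (λ x → U , r , x) rank-j)
      where
      U : Subset order
      U = sub (t i)
      r : ℕ
      r = row (t i)
      sameSize : countFin (inRow t U r) ≡ countFin (inRow t′ U r)
      sameSize = trans (rowSizes U r (rows< i)) (sym (rowSizes′ U r (rows< i)))
      found : ∃ λ j → inRow t′ U r j ≡ true × rank (inRow t′ U r) j ≡ rank (inRow t U r) i
      found = rank-surjective (inRow t′ U r) (subst (rank (inRow t U r) i <_) sameSize (rank-< (inRow t U r) (inRow-self t i)))
      j : Fin n
      j = proj₁ found
      rank-j : rank (inRow t′ U r) j ≡ rank (inRow t U r) i
      rank-j = proj₂ (proj₂ found)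
      sub≡ : sub (t′ j) ≡ U
      sub≡ = proj₁ (inRow⇒ t′ U r j (proj₁ (proj₂ found)))
      row≡ : row (t′ j) ≡ r
      row≡ = proj₂ (inRow⇒ t′ U r j (proj₁ (proj₂ found)))

    tabloidMatching : ∀ t t′ → IsTabloid σ t → IsTabloid σ t′ →
                      ∃ λ (ρ : Permutation′ n) → ∀ i → boxKey t′ (ρ ⟨$⟩ʳ i) ≡ boxKey t i
    tabloidMatching t t′ tab tab′ = permutationMatchingKeys (boxKey t) (boxKey t′)
      (boxKey-injective t) (boxKey-injective t′) (boxKey-image t t′ tab tab′) (boxKey-image t′ t tab′ tab)

    -- transport the stabiliser element z of t to one of t₀ along a matching of their boxes
    fixesTabloid⇒InC : ∀ t₀ → IsTabloid σ t₀ → ∀ z t → IsTabloid σ t → Fixes z t → InC t₀ (cycleType z)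
    fixesTabloid⇒InC t₀ tab₀ z@(⟨ g , π ⟩) t tab fixes =
      w′ , Fixes-cong w′ twist≡t₀ (Fixes-conjugate w′~z t fixes) , λ h → sym (conjugate⇒cycleType≡ w′~z h)
      where
      open CycleTypes 𝔾 n using (conjugate⇒cycleType≡)
      matching : ∃ λ (ρ : Permutation′ n) → ∀ i → boxKey t (ρ ⟨$⟩ʳ i) ≡ boxKey t₀ i
      matching = tabloidMatching t₀ t tab₀ tab
      ρ : Permutation′ n
      ρ = proj₁ matching
      e : Fin n → G
      e j = coset (t₀ j) ⊖ coset (t (ρ ⟨$⟩ʳ j))
      π′ : Permutation′ n
      π′ = (ρ ∘ₚ π) ∘ₚ flip ρ
      w′ : W
      w′ = ⟨ (λ k → (e k ⊕ g (ρ ⟨$⟩ʳ k)) ⊖ e (π′ ⟨$⟩ˡ k)) , π′ ⟩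
      w′~z : Conjugate w′ z
      w′~z = record
        { ρ = ρ ; shift = e
        ; intertwines = λ j → inverseʳ ρ
        ; twisted = λ j → trans (cong (λ x → (e (π′ ⟨$⟩ʳ j) ⊕ g (ρ ⟨$⟩ʳ (π′ ⟨$⟩ʳ j))) ⊖ e x ⊕ e j) (inverseˡ π′))
                                (x⊖y⊕y≡x _ (e j))
        }
      twist≡t₀ : ∀ j → twist ρ e t j ≡ t₀ j
      twist≡t₀ j = cong₃ entry (cong proj₁ (proj₂ matching j)) (cong (proj₁ ∘ proj₂) (proj₂ matching j))
                               (y⊕[x⊖y]≡x (coset (t₀ j)) (coset (t (ρ ⟨$⟩ʳ j))))

    sameCycleType⇒fixesTabloid : ∀ t₀ → IsTabloid σ t₀ → ∀ z w → Fixes w t₀ → (∀ h → cycleType z h ≡ cycleType w h) →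
                                 ∃ λ t → IsTabloid σ t × Fixes z t
    sameCycleType⇒fixesTabloid t₀ tab₀ z w fixes types≡ =
      twist ρ shift t₀ , twist-isTabloid σ ρ shift {t₀} tab₀ , Fixes-conjugate z~w t₀ fixes
      where
      z~w : Conjugate z w
      z~w = CycleMatching.sameCycleType⇒conjugate 𝔾 n z w types≡
      open Conjugate z~w

+/suc≡0⇒≡0 : ∀ k m → (ℤ.+ k ℚ./ suc m) ≡ 0ℚ → k ≡ 0
+/suc≡0⇒≡0 k m k/m≡0 = ℤP.+-injective (begin
  ℤ.+ k                                          ≡⟨ ℚP.↥-/ (ℤ.+ k) (suc m) ⟨
  ↥ (ℤ.+ k ℚ./ suc m) ℤ.* ℤGCD.gcd (ℤ.+ k) (ℤ.+ suc m) ≡⟨ cong (λ q → ↥ q ℤ.* ℤGCD.gcd (ℤ.+ k) (ℤ.+ suc m)) k/m≡0 ⟩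
  ℤ.+ 0 ℤ.* ℤGCD.gcd (ℤ.+ k) (ℤ.+ suc m)              ≡⟨ ℤP.*-zeroˡ (ℤGCD.gcd (ℤ.+ k) (ℤ.+ suc m)) ⟩
  ℤ.+ 0                                          ∎)
  where open ≡-Reasoning

module InnerDistribution (𝔾 : FinAbGroup) (n : ℕ) where
  open FinAbGroup 𝔾 renaming (_+_ to _⊕_; -_ to ⊝_)
  open Wreath 𝔾 n hiding (iter; cycLen)

  private
    pairInClass? : ∀ λ′ (p : W × W) → Dec (InClass ((proj₁ p ⁻¹) · proj₂ p) λ′)
    pairInClass? λ′ p = inClass? ((proj₁ p ⁻¹) · proj₂ p) λ′

  innerDist≡0 : ∀ Y λ′ → (∀ {x y} → x ∈ Y → y ∈ Y → ¬ InClass ((x ⁻¹) · y) λ′) → innerDist Y λ′ ≡ 0ℚ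
  innerDist≡0 []       λ′ _     = refl
  innerDist≡0 Y@(_ ∷ ys) λ′ never = trans
    (cong (λ m → ℤ.+ m ℚ./ suc (length ys)) (cong length (ListP.filter-none (pairInClass? λ′)
      (All.tabulate λ {p} p∈ → let x∈ , y∈ = ∈-cartesianProduct⁻ Y Y p∈ in never x∈ y∈))))
    (ℚP.0/n≡0 (suc (length ys)))

  innerDist≢0 : ∀ Y λ′ {x y} → x ∈ Y → y ∈ Y → InClass ((x ⁻¹) · y) λ′ → innerDist Y λ′ ≢ 0ℚ
  innerDist≢0 Y@(_ ∷ ys) λ′ x∈ y∈ inClass dist≡0 = ℕP.<⇒≢
    (ListP.filter-some (pairInClass? λ′) (lose (∈-cartesianProduct⁺ x∈ y∈) inClass))
    (sym (+/suc≡0⇒≡0 _ (length ys) dist≡0))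

theorem4p10 : (𝔾 : FinAbGroup) (n : ℕ) → 1 ≤ n →
    (σ : Subset (FinAbGroup.order 𝔾) → Par) → Wreath.InΣ 𝔾 n σ →
    (t₀ : Fin n → Wreath.Entry 𝔾 n) → Wreath.IsTabloid 𝔾 n σ t₀ →
    (Y : List (Wreath.W 𝔾 n)) → Y ≢ [] →
    AllPairs (λ x y → ¬ Wreath._≈W_ 𝔾 n x y) Y →
    Wreath.IsClique 𝔾 n σ Y
      ⇔ (∀ (λ′ : FinAbGroup.Carrier 𝔾 → Par) → Wreath.InΛ 𝔾 n λ′ →
           Wreath.InC 𝔾 n t₀ λ′ → λ′ (FinAbGroup.0# 𝔾) ≢ Wreath.1ⁿ 𝔾 n →
           Wreath.innerDist 𝔾 n Y λ′ ≡ 0ℚ)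
theorem4p10 𝔾 n 1≤n σ _ t₀ tab₀ Y _ _ = mk⇔ clique⇒ ⇒clique
  where
  open FinAbGroup 𝔾 using (0#)
  open Wreath 𝔾 n hiding (iter; cycLen)
  open CycleTypes 𝔾 n
  open Tabloids 𝔾 n
  open InnerDistribution 𝔾 n

  clique⇒ : IsClique σ Y → ∀ λ′ → InΛ λ′ → InC t₀ λ′ → λ′ 0# ≢ 1ⁿ → innerDist Y λ′ ≡ 0ℚ
  clique⇒ clique λ′ _ (w , w-fixes , w∈λ′) λ′0≢1ⁿ = innerDist≡0 Y λ′ λ {x} {y} x∈ y∈ xy∈λ′ →
    let x≉y : ¬ (x ≈W y)
        x≉y x≈y = λ′0≢1ⁿ (trans (sym (xy∈λ′ 0#)) (cycleType-identity (≈W⇒isIdentity x y x≈y) 1≤n))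
        t , tab , fixes = sameCycleType⇒fixesTabloid σ t₀ tab₀ ((x ⁻¹) · y) w w-fixes λ h → trans (xy∈λ′ h) (sym (w∈λ′ h))
    in clique x∈ y∈ x≉y t tab fixes

  ⇒clique : (∀ λ′ → InΛ λ′ → InC t₀ λ′ → λ′ 0# ≢ 1ⁿ → innerDist Y λ′ ≡ 0ℚ) → IsClique σ Y
  ⇒clique zeros {x} {y} x∈ y∈ x≉y t tab fixes = innerDist≢0 Y (cycleType z) x∈ y∈ (λ _ → refl)
    (zeros (cycleType z) (cycleType-InΛ z) (fixesTabloid⇒InC σ t₀ tab₀ z t tab fixes)
           (x≉y ∘ isIdentity⇒≈W x y ∘ cycleType≡1ⁿ⇒isIdentity 1≤n))
    where
    z : W
    z = (x ⁻¹) · y
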